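{- Let $G$ be a graph with edge set $E$, $k\ge1$, suppose $M_k(G)$ is a connected matroid, let $B$ be a base of $M_k(G)$ and $e\in B$, and let $A$ be the component of $G\langle B\rangle$ containing $e$. Suppose $e\notin E(\lfloor A\rfloor)$. Then exactly one of the two components of $A\setminus e$ is a tree, say $T$, and the fundamental cocircuit $K(e,B)$ equals $\{e\}\cup\{u\in E\setminus B: u \text{ has at least one end-vertex in } V(T)\}$.
   Context: Graphs are finite, may have loops and parallel edges, and have no isolated vertices; $A\setminus e$ deletes the edge $e$ and keeps all vertices (a single vertex is a tree). A leaf is a vertex incident to exactly one edge, which is not a loop. $\Delta H=|E(H)|-|V(H)|$. For $X\subseteq E$, $G\langle X\rangle$ is the subgraph with edge set $X$ and vertex set the vertices incident to $X$. For $k\ge0$, $M_k(G)$ is the matroid on $E$ whose circuits are the inclusion-minimal members of $\{C\subseteq E:C\neq\emptyset,\ |C|=|V(G\langle C\rangle)|+k\}$. A matroid is connected if its ground set has at least two elements and every two elements lie in a common circuit. For a base $B$ and $e\in B$, $K(e,B)$ is the unique cocircuit $K$ of the matroid with $K\cap B=\{e\}$. For a connected graph $A$ containing a cycle, its kernel $\lfloor A\rfloor$ is the subgraph obtained by repeatedly deleting leaves (with their incident edges) until no leaf remains (the components of $G\langle B\rangle$ each contain a cycle here). -}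

module Defs where

open import Data.Fin using (Fin)
open import Data.Fin.Properties using (_≟_; any?)
open import Data.Fin.Subset
open import Data.Fin.Subset.Properties using (_∈?_; p─q⊆p)
open import Data.List using (List; []; _∷_)
open import Data.List.Relation.Unary.Unique.Propositional using (Unique)
open import Data.Nat using (ℕ; _+_; _≤_)
open import Data.Product using (∃-syntax; ∃₂; _×_; _,_; proj₁; proj₂)
open import Data.Sum using (_⊎_; inj₁; inj₂)
open import Data.Vec using (tabulate)
open import Data.Vec.Properties using (lookup⇒[]=; lookup∘tabulate)
open import Relation.Binary.Construct.Closure.ReflexiveTransitive using (Star)
open import Relation.Binary.PropositionalEquality using (_≡_; _≢_; refl; trans)
open import Relation.Nullary using (¬_; Dec; does; _×-dec_; _⊎-dec_)
open import Relation.Nullary.Decidable using (dec-true)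
open import Relation.Unary using (Pred; Decidable)
open import Level using (0ℓ)

private
  variable
    n m : ℕ

⟦_⟧ : {P : Pred (Fin n) 0ℓ} → Decidable P → Subset n
⟦ P? ⟧ = tabulate (λ x → does (P? x))

∈-⟦⟧ : {P : Pred (Fin n) 0ℓ} (P? : Decidable P) {x : Fin n} → P x → x ∈ ⟦ P? ⟧
∈-⟦⟧ P? {x} px =
  lookup⇒[]= x _ (trans (lookup∘tabulate (λ y → does (P? y)) x) (dec-true (P? x) px))

Minimal : Pred (Subset n) 0ℓ → Pred (Subset n) 0ℓ
Minimal P X = P X × (∀ Y → P Y → Y ⊆ X → Y ≡ X)

Maximal : Pred (Subset n) 0ℓ → Pred (Subset n) 0ℓ
Maximal P X = P X × (∀ Y → P Y → X ⊆ Y → Y ≡ X)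

-- A matroid on Fin m is presented by the family of its circuits; the notions
-- below are the usual ones and do not mention the circuit axioms.
module Matroid {m : ℕ} (Circuit : Pred (Subset m) 0ℓ) where

  Independent : Pred (Subset m) 0ℓ
  Independent I = ∀ C → Circuit C → ¬ (C ⊆ I)

  Base : Pred (Subset m) 0ℓ
  Base = Maximal Independent

  -- Independence in the dual matroid, whose bases are the complements of bases.
  Coindependent : Pred (Subset m) 0ℓ
  Coindependent I = ∃[ B ] (Base B × I ⊆ ∁ B)

  Cocircuit : Pred (Subset m) 0ℓ
  Cocircuit = Minimal (λ K → ¬ Coindependent K)

  ConnectedMatroid : Set
  ConnectedMatroid =
    2 ≤ m × (∀ x y → x ≢ y → ∃[ C ] (Circuit C × x ∈ C × y ∈ C))

  -- K = K(e,B): K is a cocircuit meeting B exactly in e, and the only one.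
  IsFundamentalCocircuit : Fin m → Subset m → Pred (Subset m) 0ℓ
  IsFundamentalCocircuit e B K =
    Cocircuit K × K ∩ B ≡ ⁅ e ⁆ ×
    (∀ K′ → Cocircuit K′ → K′ ∩ B ≡ ⁅ e ⁆ → K′ ≡ K)

-- Vertex set Fin n and edge set Fin m.  The order of the two ends of an edge is
-- immaterial; a loop has equal ends.
record Graph (n m : ℕ) : Set where
  field
    end₁ end₂ : Fin m → Fin n

  Incident : Fin n → Fin m → Set
  Incident v f = end₁ f ≡ v ⊎ end₂ f ≡ v

  incident? : ∀ v f → Dec (Incident v f)
  incident? v f = (end₁ f ≟ v) ⊎-dec (end₂ f ≟ v)

  field
    noIsolated : ∀ v → ∃[ f ] Incident v f

  Loop : Fin m → Set
  Loop f = end₁ f ≡ end₂ f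

  Joins : Fin m → Fin n → Fin n → Set
  Joins f u v = (end₁ f ≡ u × end₂ f ≡ v) ⊎ (end₁ f ≡ v × end₂ f ≡ u)

  -- V(G⟨X⟩)
  spanned : Subset m → Subset n
  spanned X = ⟦ (λ v → any? (λ f → (f ∈? X) ×-dec incident? v f)) ⟧

  edgesMeeting : Subset n → Subset m
  edgesMeeting W = ⟦ (λ f → (end₁ f ∈? W) ⊎-dec (end₂ f ∈? W)) ⟧

-- Unlike G itself, a subgraph may have isolated vertices.
record Subgraph (G : Graph n m) : Set where
  open Graph G
  field
    V : Subset n
    E : Subset m
    closed : ∀ f → f ∈ E → end₁ f ∈ V × end₂ f ∈ V

open Subgraph public

module _ {G : Graph n m} where
  open Graph G

  infix 4 _⊑_ _≈_

  _⊑_ : Subgraph G → Subgraph G → Set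
  H ⊑ H′ = V H ⊆ V H′ × E H ⊆ E H′

  -- Equality of subgraphs, disregarding the proofs of closedness.
  _≈_ : Subgraph G → Subgraph G → Set
  H ≈ H′ = V H ≡ V H′ × E H ≡ E H′

  infixl 6 _∖_

  _∖_ : Subgraph G → Fin m → Subgraph G
  H ∖ e = record
    { V = V H
    ; E = E H - e
    ; closed = λ f f∈ → closed H f (p─q⊆p (E H) ⁅ e ⁆ f∈)
    }

  data Walk (H : Subgraph G) : Fin n → Fin n → Set where
    nil  : ∀ {v} → v ∈ V H → Walk H v v
    cons : ∀ {u v w} f → f ∈ E H → Joins f u v → Walk H v w → Walk H u w

  walkEdges : ∀ {H u v} → Walk H u v → List (Fin m)
  walkEdges (nil _)        = []
  walkEdges (cons f _ _ p) = f ∷ walkEdges p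

  -- The vertices of a walk in order, without the last one.
  walkSources : ∀ {H u v} → Walk H u v → List (Fin n)
  walkSources (nil _)            = []
  walkSources (cons {u} _ _ _ p) = u ∷ walkSources p

  -- Loops are cycles of length 1, pairs of parallel edges cycles of length 2;
  -- distinctness of the edges excludes traversing one edge back and forth.
  IsCycle : ∀ {H v} → Walk H v v → Set
  IsCycle p = walkEdges p ≢ [] × Unique (walkEdges p) × Unique (walkSources p)

  Acyclic : Subgraph G → Set
  Acyclic H = ∀ v (p : Walk H v v) → ¬ IsCycle p

  Connected : Subgraph G → Set
  Connected H = Nonempty (V H) × (∀ u v → u ∈ V H → v ∈ V H → Walk H u v)

  IsTree : Subgraph G → Set
  IsTree H = Connected H × Acyclic H

  IsComponent : Subgraph G → Subgraph G → Set
  IsComponent C H =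
    C ⊑ H × Connected C × (∀ D → D ⊑ H → Connected D → C ⊑ D → D ≈ C)

  -- v is a leaf of H, and f is its only edge.
  LeafAt : Subgraph G → Fin n → Fin m → Set
  LeafAt H v f =
    v ∈ V H × f ∈ E H × Incident v f × ¬ Loop f ×
    (∀ g → g ∈ E H → Incident v g → g ≡ f)

  LeafDeletion : Subgraph G → Subgraph G → Set
  LeafDeletion H H′ = ∃₂ λ v f → LeafAt H v f × V H′ ≡ V H - v × E H′ ≡ E H - f

  -- N is what remains of A after deleting leaves, in some order, until none is left.
  IsKernel : Subgraph G → Subgraph G → Set
  IsKernel N A = Star LeafDeletion A N × (∀ v f → ¬ LeafAt N v f)

_⟨_⟩ : (G : Graph n m) → Subset m → Subgraph G
G ⟨ X ⟩ = record
  { V = spanned X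
  ; E = X
  ; closed = λ f f∈X →
      ∈-⟦⟧ (λ v → any? (λ g → (g ∈? X) ×-dec incident? v g)) (f , f∈X , inj₁ refl) ,
      ∈-⟦⟧ (λ v → any? (λ g → (g ∈? X) ×-dec incident? v g)) (f , f∈X , inj₂ refl)
  }
  where open Graph G

-- The circuits of M_k(G).
MCircuit : ℕ → Graph n m → Pred (Subset m) 0ℓ
MCircuit k G = Minimal (λ C → Nonempty C × ∣ C ∣ ≡ ∣ V (G ⟨ C ⟩) ∣ + k)

{-# OPTIONS --safe #-}

-- A set is independent iff |Z| < |V(Z)| + k for each of its subsets Z.  Tight subsets of a
-- base (|Z| = |V(Z)| + k - 1) are closed under union, and connectedness forces the largest
-- one to span G, so every base B has |V(G)| + k - 1 edges.  Hence at least |W| edges of B meet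
-- any vertex set W.
--
-- Since e is removed when the kernel is formed, at that moment one of its ends is a leaf, so
-- the component T of A \ e at this end carries no cycle; by the count above B cannot leave
-- trees on both sides of e.  A base missing the proposed cocircuit could meet V(T) only in
-- edges of T, of which there are fewer than |V(T)|; conversely, if u outside B meets V(T),
-- then B - e + u is independent, because what a dense subset has inside T can be discarded.
module Submission where

open import Defs
open import Data.Bool using (true; false)
open import Data.Empty using () renaming (⊥ to ⊥ᵉ)
open import Data.Fin using (Fin; zero; suc; fromℕ<)
open import Data.Fin.Properties using (_≟_; any?; all?)
open import Data.Fin.Subset using (Subset; _∈_; _∉_; _⊆_; _⊂_; _⊃_; ⁅_⁆; ∁; _∩_; _∪_; _─_; _-_; ∣_∣; ⊤; ⊥; Nonempty)
open import Data.Fin.Subset.Induction using (⊂-wellFounded; ⊃-wellFounded)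
open import Data.Fin.Subset.Properties
open import Data.List using (List; []; _∷_)
open import Data.List.Membership.Propositional using () renaming (_∈_ to _∈ₗ_)
open import Data.List.Relation.Unary.All using (All; []; _∷_)
open import Data.List.Relation.Unary.All.Properties using (¬Any⇒All¬; All¬⇒¬Any)
open import Data.List.Relation.Unary.AllPairs using ([]; _∷_)
open import Data.List.Relation.Unary.Any using (here; there)
open import Data.List.Relation.Unary.Unique.Propositional using (Unique)
open import Data.Nat using (ℕ; zero; suc; _+_; _≤_; _<_; _≤?_; s≤s; s≤s⁻¹)
open import Data.Nat.Properties hiding (_≟_)
open import Algebra.Properties.CommutativeSemigroup +-commutativeSemigroup using (xy∙z≈xz∙y; interchange)
open import Data.Product using (_×_; _,_; proj₁; proj₂; ∃-syntax)
open import Data.Sum using (_⊎_; inj₁; inj₂; [_,_]′) renaming (map to map⊎)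
open import Data.Vec using ([]; _∷_; here; there)
open import Data.Vec.Properties using (lookup∘tabulate; []=⇒lookup)
open import Function using (_∘_)
open import Induction.WellFounded using (Acc; acc)
open import Level using (0ℓ)
open import Relation.Binary.Construct.Closure.ReflexiveTransitive using (Star; ε; _◅_)
open import Relation.Binary.PropositionalEquality using (_≡_; _≢_; refl; sym; trans; cong; subst)
open import Relation.Nullary using (¬_; Dec; yes; no; does; contradiction; ¬?; _×-dec_; _⊎-dec_; _→-dec_)
open import Relation.Nullary.Decidable using (decidable-stable)
open import Relation.Unary using (Pred; Decidable)

private
  variable
    n m : ℕ

-- Finite subsets

⟦⟧-∈ : {P : Pred (Fin n) 0ℓ} (P? : Decidable P) {x : Fin n} → x ∈ ⟦ P? ⟧ → P x
⟦⟧-∈ P? {x} x∈ with P? x | trans (sym (lookup∘tabulate (does ∘ P?) x)) ([]=⇒lookup x∈)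
... | yes px | _ = px
... | no _   | ()

x∈p─q⇒x∉q : ∀ (p q : Subset n) {x} → x ∈ p ─ q → x ∉ q
x∈p─q⇒x∉q (_ ∷ p) (_ ∷ q) (there x∈) (there x∈q) = x∈p─q⇒x∉q p q x∈ x∈q
x∈p─q⇒x∉q (_ ∷ p) (true ∷ q) () here

x∈p-y⇒x≢y : ∀ (p : Subset n) {x y} → x ∈ p - y → x ≢ y
x∈p-y⇒x≢y p {y = y} x∈ refl = x∈p─q⇒x∉q p ⁅ y ⁆ x∈ (x∈⁅x⁆ y)

∣p∪q∣+∣p∩q∣≡∣p∣+∣q∣ : ∀ (p q : Subset n) → ∣ p ∪ q ∣ + ∣ p ∩ q ∣ ≡ ∣ p ∣ + ∣ q ∣
∣p∪q∣+∣p∩q∣≡∣p∣+∣q∣ []          []          = refl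
∣p∪q∣+∣p∩q∣≡∣p∣+∣q∣ (true ∷ p)  (true ∷ q)  =
  cong suc (trans (+-suc ∣ p ∪ q ∣ _) (trans (cong suc (∣p∪q∣+∣p∩q∣≡∣p∣+∣q∣ p q)) (sym (+-suc ∣ p ∣ _))))
∣p∪q∣+∣p∩q∣≡∣p∣+∣q∣ (true ∷ p)  (false ∷ q) = cong suc (∣p∪q∣+∣p∩q∣≡∣p∣+∣q∣ p q)
∣p∪q∣+∣p∩q∣≡∣p∣+∣q∣ (false ∷ p) (true ∷ q)  =
  trans (cong suc (∣p∪q∣+∣p∩q∣≡∣p∣+∣q∣ p q)) (sym (+-suc ∣ p ∣ _))
∣p∪q∣+∣p∩q∣≡∣p∣+∣q∣ (false ∷ p) (false ∷ q) = ∣p∪q∣+∣p∩q∣≡∣p∣+∣q∣ p q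

∣p∪q∣≤∣p∣+∣q∣ : ∀ (p q : Subset n) → ∣ p ∪ q ∣ ≤ ∣ p ∣ + ∣ q ∣
∣p∪q∣≤∣p∣+∣q∣ p q = ≤-trans (m≤m+n _ ∣ p ∩ q ∣) (≤-reflexive (∣p∪q∣+∣p∩q∣≡∣p∣+∣q∣ p q))

p⊆q∪r⇒∣p∣≤∣q∣+∣r∣ : ∀ {p : Subset n} q r → p ⊆ q ∪ r → ∣ p ∣ ≤ ∣ q ∣ + ∣ r ∣
p⊆q∪r⇒∣p∣≤∣q∣+∣r∣ q r p⊆ = ≤-trans (p⊆q⇒∣p∣≤∣q∣ p⊆) (∣p∪q∣≤∣p∣+∣q∣ q r)

∪-⊆ : ∀ {p q r : Subset n} → p ⊆ r → q ⊆ r → p ∪ q ⊆ r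
∪-⊆ {p = p} {q} p⊆r q⊆r x∈ = [ p⊆r , q⊆r ]′ (x∈p∪q⁻ p q x∈)

disjoint⇒∣p∣+∣q∣≤∣r∣ : ∀ {p q r : Subset n} → p ⊆ r → q ⊆ r → (∀ {x} → x ∈ p → x ∉ q) → ∣ p ∣ + ∣ q ∣ ≤ ∣ r ∣
disjoint⇒∣p∣+∣q∣≤∣r∣ {n} {p} {q} {r} p⊆r q⊆r disj = begin
  ∣ p ∣ + ∣ q ∣          ≡⟨ sym (∣p∪q∣+∣p∩q∣≡∣p∣+∣q∣ p q) ⟩
  ∣ p ∪ q ∣ + ∣ p ∩ q ∣  ≡⟨ cong (∣ p ∪ q ∣ +_) (trans (cong ∣_∣ p∩q≡⊥) (∣⊥∣≡0 n)) ⟩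
  ∣ p ∪ q ∣ + 0          ≡⟨ +-identityʳ _ ⟩
  ∣ p ∪ q ∣              ≤⟨ p⊆q⇒∣p∣≤∣q∣ (∪-⊆ p⊆r q⊆r) ⟩
  ∣ r ∣                  ∎
  where
  open ≤-Reasoning
  p∩q≡⊥ : p ∩ q ≡ ⊥
  p∩q≡⊥ = Empty-unique λ (_ , x∈) → let x∈p , x∈q = x∈p∩q⁻ p q x∈ in disj x∈p x∈q

⊆∧∣q∣≤∣p∣⇒q⊆p : ∀ {p q : Subset n} → p ⊆ q → ∣ q ∣ ≤ ∣ p ∣ → q ⊆ p
⊆∧∣q∣≤∣p∣⇒q⊆p {p = p} p⊆q q≤p {x} x∈q = decidable-stable (x ∈? p) λ x∉p →
  <⇒≱ (p⊂q⇒∣p∣<∣q∣ (p⊆q , x , x∈q , x∉p)) q≤p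

∣p∣≤1+∣p-x∣ : ∀ (p : Subset n) x → ∣ p ∣ ≤ suc ∣ p - x ∣
∣p∣≤1+∣p-x∣ p x = subst (λ c → ∣ p ∣ ≤ c + ∣ p - x ∣) (∣⁅x⁆∣≡1 x) (p⊆q∪r⇒∣p∣≤∣q∣+∣r∣ ⁅ x ⁆ (p - x) split)
  where
  split : p ⊆ ⁅ x ⁆ ∪ (p - x)
  split {y} y∈p with y ≟ x
  ... | yes refl = x∈p∪q⁺ (inj₁ (x∈⁅x⁆ x))
  ... | no y≢x   = x∈p∪q⁺ (inj₂ (x∈p∧x≢y⇒x∈p-y y∈p y≢x))

positive⇒Nonempty : ∀ {p : Subset n} → 0 < ∣ p ∣ → Nonempty p
positive⇒Nonempty {n} {p} 0<p = decidable-stable (nonempty? p) λ empty →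
  <⇒≢ 0<p (sym (trans (cong ∣_∣ (Empty-unique empty)) (∣⊥∣≡0 n)))

minimal : {P : Pred (Subset n) 0ℓ} → Decidable P → ∀ X → P X → ∃[ Y ] (Minimal P Y × Y ⊆ X)
minimal {n} {P} P? X = go X (⊂-wellFounded X)
  where
  go : ∀ X → Acc _⊂_ X → P X → ∃[ Y ] (Minimal P Y × Y ⊆ X)
  go X (acc rec) PX with anySubset? (λ Y → P? Y ×-dec (Y ⊂? X))
  ... | yes (Y , PY , Y⊂X) = let Z , min , Z⊆Y = go Y (rec Y⊂X) PY in Z , min , ⊆-trans Z⊆Y (proj₁ Y⊂X)
  ... | no none = X , (PX , λ Y PY Y⊆X → ⊆-antisym Y⊆X λ {x} x∈X →
          decidable-stable (x ∈? Y) λ x∉Y → none (Y , PY , Y⊆X , x , x∈X , x∉Y)) , ⊆-refl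

maximal : {P : Pred (Subset n) 0ℓ} → Decidable P → ∀ X → P X → ∃[ Y ] Maximal P Y
maximal {n} {P} P? X = go X (⊃-wellFounded X)
  where
  go : ∀ X → Acc _⊃_ X → P X → ∃[ Y ] Maximal P Y
  go X (acc rec) PX with anySubset? (λ Y → P? Y ×-dec (X ⊂? Y))
  ... | yes (Y , PY , X⊂Y) = go Y (rec X⊂Y) PY
  ... | no none = X , PX , λ Y PY X⊆Y → ⊆-antisym (λ {x} x∈Y →
          decidable-stable (x ∈? X) λ x∉X → none (Y , PY , X⊆Y , x , x∈Y , x∉X)) X⊆Y

-- Counting in M_k(G)

module _ (G : Graph n m) where
  open Graph G

  private
    covers? : ∀ X v → Dec (∃[ f ] (f ∈ X × Incident v f))
    covers? X v = any? λ f → (f ∈? X) ×-dec incident? v f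

    meets? : ∀ W f → Dec (end₁ f ∈ W ⊎ end₂ f ∈ W)
    meets? W f = (end₁ f ∈? W) ⊎-dec (end₂ f ∈? W)

  ∈-spanned⁺ : ∀ {X f v} → f ∈ X → Incident v f → v ∈ spanned X
  ∈-spanned⁺ {X} f∈X v~f = ∈-⟦⟧ (covers? X) (_ , f∈X , v~f)

  ∈-spanned⁻ : ∀ {X v} → v ∈ spanned X → ∃[ f ] (f ∈ X × Incident v f)
  ∈-spanned⁻ {X} = ⟦⟧-∈ (covers? X)

  spanned-mono : ∀ {X Y} → X ⊆ Y → spanned X ⊆ spanned Y
  spanned-mono X⊆Y v∈ = let f , f∈X , v~f = ∈-spanned⁻ v∈ in ∈-spanned⁺ (X⊆Y f∈X) v~f

  ∈-edgesMeeting⁺ : ∀ {W f v} → Incident v f → v ∈ W → f ∈ edgesMeeting W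
  ∈-edgesMeeting⁺ {W} v~f v∈W = ∈-⟦⟧ (meets? W) ([ (λ { refl → inj₁ v∈W }) , (λ { refl → inj₂ v∈W }) ]′ v~f)

  ∈-edgesMeeting⁻ : ∀ {W f} → f ∈ edgesMeeting W → ∃[ v ] (Incident v f × v ∈ W)
  ∈-edgesMeeting⁻ {W} f∈ with ⟦⟧-∈ (meets? W) f∈
  ... | inj₁ v∈ = _ , inj₁ refl , v∈
  ... | inj₂ v∈ = _ , inj₂ refl , v∈

-- Dense, sparse and tight edge sets.

module Count (G : Graph n m) (k : ℕ) where
  open Graph G
  open Matroid (MCircuit k G)

  -- The equation defining circuits is relaxed to an inequality, so that an edge count from below
  -- suffices to find a circuit; see `dense⇒circuit`.
  Dense : Subset m → Set
  Dense X = ∣ spanned X ∣ + k ≤ ∣ X ∣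

  dense? : Decidable Dense
  dense? X = _ ≤? _

  Sparse : Subset m → Set
  Sparse X = ∀ Z → Z ⊆ X → ¬ Dense Z

  -- For a subset of a sparse set this is equality, |X| = |V(X)| + k - 1; the `suc` avoids the
  -- subtraction.
  Tight : Subset m → Set
  Tight X = ∣ spanned X ∣ + k ≤ suc ∣ X ∣

  sparse⇒independent : ∀ {X} → Sparse X → Independent X
  sparse⇒independent sparse C ((_ , ∣C∣≡) , _) C⊆X = sparse C C⊆X (≤-reflexive (sym ∣C∣≡))

  sparse-or-dense : ∀ X → Sparse X ⊎ ∃[ Z ] (Dense Z × Z ⊆ X)
  sparse-or-dense X with anySubset? (λ Z → dense? Z ×-dec (Z ⊆? X))
  ... | yes found = inj₂ found
  ... | no none   = inj₁ λ Z Z⊆X dense → none (Z , dense , Z⊆X)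

  -- Uncrossing: the number of spanned vertices is submodular, and `Y ∩ Z`, being a subset of `B`,
  -- is not dense. All slack of the union is therefore used up.
  ∪-tight : ∀ {B Y Z} → Sparse B → Y ⊆ B → Tight Y → Tight Z → Tight (Y ∪ Z)
  ∪-tight {B} {Y} {Z} sparse Y⊆B tightY tightZ =
    +-cancelʳ-≤ (suc ∣ Y ∩ Z ∣) (∣ spanned (Y ∪ Z) ∣ + k) (suc ∣ Y ∪ Z ∣) (begin
    ∣ spanned (Y ∪ Z) ∣ + k + suc ∣ Y ∩ Z ∣
      ≤⟨ +-monoʳ-≤ (∣ spanned (Y ∪ Z) ∣ + k) (≰⇒> (sparse (Y ∩ Z) (Y⊆B ∘ p∩q⊆p Y Z))) ⟩
    ∣ spanned (Y ∪ Z) ∣ + k + (∣ spanned (Y ∩ Z) ∣ + k)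
      ≤⟨ +-mono-≤ (+-monoˡ-≤ k (p⊆q⇒∣p∣≤∣q∣ s∪)) (+-monoˡ-≤ k (p⊆q⇒∣p∣≤∣q∣ s∩)) ⟩
    ∣ sY ∪ sZ ∣ + k + (∣ sY ∩ sZ ∣ + k)
      ≡⟨ interchange ∣ sY ∪ sZ ∣ k _ k ⟩
    ∣ sY ∪ sZ ∣ + ∣ sY ∩ sZ ∣ + (k + k)
      ≡⟨ cong (_+ (k + k)) (∣p∪q∣+∣p∩q∣≡∣p∣+∣q∣ sY sZ) ⟩
    ∣ sY ∣ + ∣ sZ ∣ + (k + k)
      ≡⟨ sym (interchange ∣ sY ∣ k _ k) ⟩
    ∣ sY ∣ + k + (∣ sZ ∣ + k)
      ≤⟨ +-mono-≤ tightY tightZ ⟩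
    suc ∣ Y ∣ + suc ∣ Z ∣
      ≡⟨ cong suc (+-suc ∣ Y ∣ ∣ Z ∣) ⟩
    suc (suc (∣ Y ∣ + ∣ Z ∣))
      ≡⟨ cong (2 +_) (sym (∣p∪q∣+∣p∩q∣≡∣p∣+∣q∣ Y Z)) ⟩
    suc (suc (∣ Y ∪ Z ∣ + ∣ Y ∩ Z ∣))
      ≡⟨ cong suc (sym (+-suc ∣ Y ∪ Z ∣ ∣ Y ∩ Z ∣)) ⟩
    suc ∣ Y ∪ Z ∣ + suc ∣ Y ∩ Z ∣ ∎)
    where
    open ≤-Reasoning
    sY = spanned Y
    sZ = spanned Z

    s∪ : spanned (Y ∪ Z) ⊆ sY ∪ sZ
    s∪ v∈ with ∈-spanned⁻ G v∈
    ... | f , f∈ , v~f with x∈p∪q⁻ Y Z f∈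
    ...   | inj₁ f∈Y = x∈p∪q⁺ (inj₁ (∈-spanned⁺ G f∈Y v~f))
    ...   | inj₂ f∈Z = x∈p∪q⁺ (inj₂ (∈-spanned⁺ G f∈Z v~f))

    s∩ : spanned (Y ∩ Z) ⊆ sY ∩ sZ
    s∩ v∈ = x∈p∩q⁺ (spanned-mono G (p∩q⊆p Y Z) v∈ , spanned-mono G (p∩q⊆q Y Z) v∈)

  module _ (1≤k : 1 ≤ k) where

    -- Deleting an edge lowers |X| - |V(X)| by at most one, so a minimal dense set
    -- attains the bound and is a circuit.
    dense⇒circuit : ∀ {X} → Dense X → ∃[ C ] (MCircuit k G C × C ⊆ X)
    dense⇒circuit {X} denseX = let C , (dense , min) , C⊆X = minimal dense? X denseX in
      C , ((nonempty dense , ≤-antisym (upper dense min) dense) ,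
           λ Y (_ , ∣Y∣≡) → min Y (≤-reflexive (sym ∣Y∣≡))) , C⊆X
      where
      nonempty : ∀ {C} → Dense C → Nonempty C
      -- A dense set has at least `k` edges, and `k` is positive.
      nonempty dense = positive⇒Nonempty (≤-trans 1≤k (≤-trans (m≤n+m k _) dense))

      upper : ∀ {C} → Dense C → (∀ Y → Dense Y → Y ⊆ C → Y ≡ C) → ∣ C ∣ ≤ ∣ spanned C ∣ + k
      upper {C} dense min = ≮⇒≥ λ slack →
        let f , f∈C = nonempty dense
            C-f⊆C   = p─q⊆p C ⁅ f ⁆
            dense′  = ≤-trans (+-monoˡ-≤ k (p⊆q⇒∣p∣≤∣q∣ (spanned-mono G C-f⊆C)))
                        (s≤s⁻¹ (≤-trans slack (∣p∣≤1+∣p-x∣ C f)))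
        in x∈p-y⇒x≢y C (subst (f ∈_) (sym (min (C - f) dense′ C-f⊆C)) f∈C) refl

    independent⇒sparse : ∀ {X} → Independent X → Sparse X
    independent⇒sparse indep Z Z⊆X dense =
      let C , circuit , C⊆Z = dense⇒circuit dense in indep C circuit (Z⊆X ∘ C⊆Z)

    -- Adding x to B creates a circuit; its part in B is tight and has the same span.
    tight-span : ∀ {B} → Base B → ∀ x → x ∉ B →
                 ∃[ Y ] (Y ⊆ B × Tight Y × (∀ {v} → Incident v x → v ∈ spanned Y))
    tight-span {B} (indep , max) x x∉B with sparse-or-dense (B ∪ ⁅ x ⁆)
    ... | inj₁ sparse = contradiction
            (subst (x ∈_) (max _ (sparse⇒independent sparse) (p⊆p∪q ⁅ x ⁆)) (q⊆p∪q B ⁅ x ⁆ (x∈⁅x⁆ x))) x∉B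
    ... | inj₂ (Z , dense , Z⊆) = Y , Y⊆B , tight , λ x~v → sZ⊆sY (∈-spanned⁺ G x∈Z x~v)
      where
      Z⊆B∨x : ∀ {f} → f ∈ Z → f ∈ B ⊎ f ≡ x
      Z⊆B∨x f∈Z with x∈p∪q⁻ B ⁅ x ⁆ (Z⊆ f∈Z)
      ... | inj₁ f∈B = inj₁ f∈B
      ... | inj₂ f∈x = inj₂ (x∈⁅y⁆⇒x≡y x f∈x)

      x∈Z : x ∈ Z
      x∈Z = decidable-stable (x ∈? Z) λ x∉Z → independent⇒sparse indep Z
        (λ f∈Z → [ (λ f∈B → f∈B) , (λ { refl → contradiction f∈Z x∉Z }) ]′ (Z⊆B∨x f∈Z)) dense

      Y = Z - x
      Y⊆Z = p─q⊆p Z ⁅ x ⁆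

      Y⊆B : Y ⊆ B
      Y⊆B f∈Y = [ (λ f∈B → f∈B) , (λ f≡x → contradiction f≡x (x∈p-y⇒x≢y Z f∈Y)) ]′ (Z⊆B∨x (Y⊆Z f∈Y))

      ∣sZ∣+k≤1+∣Y∣ = ≤-trans dense (∣p∣≤1+∣p-x∣ Z x)

      tight : Tight Y
      tight = ≤-trans (+-monoˡ-≤ k (p⊆q⇒∣p∣≤∣q∣ (spanned-mono G Y⊆Z))) ∣sZ∣+k≤1+∣Y∣

      -- `Y` lies in `B` and is not dense, so |V(Z)| + k ≤ |Y| + 1 ≤ |V(Y)| + k. The nested spans
      -- thus have the same size.
      sZ⊆sY : spanned Z ⊆ spanned Y
      sZ⊆sY = ⊆∧∣q∣≤∣p∣⇒q⊆p (spanned-mono G Y⊆Z) (+-cancelʳ-≤ k _ _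
        (≤-trans ∣sZ∣+k≤1+∣Y∣ (≰⇒> (independent⇒sparse indep Y Y⊆B))))

    private
      another : 2 ≤ m → ∀ (x : Fin m) → ∃[ y ] x ≢ y
      another (s≤s (s≤s _)) zero    = suc zero , λ ()
      another (s≤s (s≤s _)) (suc _) = zero , λ ()

    -- The number of edges of a base of a connected matroid.

    module _ (connected : ConnectedMatroid) where

      circuit-through : ∀ x → ∃[ C ] (MCircuit k G C × x ∈ C)
      circuit-through x =
        let y , x≢y = another (proj₁ connected) x
            C , circuit , x∈C , _ = proj₂ connected x y x≢y
        in C , circuit , x∈C

      -- The part of a circuit meeting the complement of the span of a tight Y lies in B,
      -- so it has too few edges for its removal to leave a set that is not dense.
      span-closed : ∀ {B Y} → Sparse B → Y ⊆ B → Tight Y →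
        (∀ {x v} → x ∉ B → Incident v x → v ∈ spanned Y) →
        ∀ {C v} → MCircuit k G C → v ∈ spanned C → v ∈ spanned Y
      span-closed {B} {Y} sparse Y⊆B tight outside {C} {v} circuit v∈sC =
        -- A vertex outside `W` puts an edge of `C` into `D`. But `C ─ D` is dense, so it contains a
        -- circuit, which by minimality is all of `C`.
        decidable-stable (v ∈? W) λ v∉W →
        let f , f∈C , v~f = ∈-spanned⁻ G v∈sC
            f∈D = x∈p∩q⁺ (f∈C , ∈-edgesMeeting⁺ G v~f (x∉p⇒x∈∁p v∉W))
            C′ , circuit′ , C′⊆ = dense⇒circuit denseC─D
            C′≡C = proj₂ circuit C′ (proj₁ circuit′) (p─q⊆p C D ∘ C′⊆)
        in x∈p─q⇒x∉q C D (C′⊆ (subst (f ∈_) (sym C′≡C) f∈C)) f∈D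
        where
        open ≤-Reasoning
        W  = spanned Y
        sC = spanned C
        D  = C ∩ edgesMeeting (∁ W)

        D-end : ∀ {f} → f ∈ D → ∃[ w ] (Incident w f × w ∉ W)
        D-end f∈D = let w , w~f , w∈ = ∈-edgesMeeting⁻ G (p∩q⊆q C _ f∈D) in w , w~f , x∈∁p⇒x∉p w∈

        D⊆B : D ⊆ B
        D⊆B {f} f∈D = decidable-stable (f ∈? B) λ f∉B →
          let w , w~f , w∉W = D-end f∈D in w∉W (outside f∉B w~f)

        Y-D-disjoint : ∀ {f} → f ∈ Y → f ∉ D
        Y-D-disjoint f∈Y f∈D = let w , w~f , w∉W = D-end f∈D in w∉W (∈-spanned⁺ G f∈Y w~f)

        s[Y∪D]⊆ : spanned (Y ∪ D) ⊆ W ∪ (sC ─ W)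
        s[Y∪D]⊆ {w} w∈ with w ∈? W
        ... | yes w∈W = x∈p∪q⁺ (inj₁ w∈W)
        ... | no w∉W with ∈-spanned⁻ G w∈
        ...   | f , f∈ , w~f with x∈p∪q⁻ Y D f∈
        ...     | inj₁ f∈Y = contradiction (∈-spanned⁺ G f∈Y w~f) w∉W
        ...     | inj₂ f∈D = x∈p∪q⁺ (inj₂ (x∈p∧x∉q⇒x∈p─q (∈-spanned⁺ G (p∩q⊆p C _ f∈D) w~f) w∉W))

        -- `Y` is tight while `Y ∪ D` is not dense: `D` has at most as many edges as it brings new
        -- vertices, and these lie in `sC ─ W`.
        ∣D∣≤ : ∣ D ∣ ≤ ∣ sC ─ W ∣
        ∣D∣≤ = +-cancelˡ-≤ (suc ∣ Y ∣) _ _ (begin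
          suc (∣ Y ∣ + ∣ D ∣)
            ≤⟨ s≤s (disjoint⇒∣p∣+∣q∣≤∣r∣ (p⊆p∪q D) (q⊆p∪q Y D) Y-D-disjoint) ⟩
          suc ∣ Y ∪ D ∣
            ≤⟨ ≰⇒> (sparse (Y ∪ D) (∪-⊆ Y⊆B D⊆B)) ⟩
          ∣ spanned (Y ∪ D) ∣ + k
            ≤⟨ +-monoˡ-≤ k (p⊆q∪r⇒∣p∣≤∣q∣+∣r∣ W (sC ─ W) s[Y∪D]⊆) ⟩
          ∣ W ∣ + ∣ sC ─ W ∣ + k
            ≡⟨ xy∙z≈xz∙y ∣ W ∣ _ k ⟩
          ∣ W ∣ + k + ∣ sC ─ W ∣
            ≤⟨ +-monoˡ-≤ _ tight ⟩
          suc ∣ Y ∣ + ∣ sC ─ W ∣ ∎)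

        s[C─D]∩[sC─W]≡∅ : ∀ {w} → w ∈ spanned (C ─ D) → w ∉ sC ─ W
        s[C─D]∩[sC─W]≡∅ w∈ w∈sC─W =
          let f , f∈ , w~f = ∈-spanned⁻ G w∈
              w∉W = x∈p─q⇒x∉q sC W w∈sC─W
          in x∈p─q⇒x∉q C D f∈ (x∈p∩q⁺ (p─q⊆p C D f∈ , ∈-edgesMeeting⁺ G w~f (x∉p⇒x∈∁p w∉W)))

        C⊆ : C ⊆ (C ─ D) ∪ D
        C⊆ {f} f∈C with f ∈? D
        ... | yes f∈D = x∈p∪q⁺ (inj₂ f∈D)
        ... | no f∉D  = x∈p∪q⁺ (inj₁ (x∈p∧x∉q⇒x∈p─q f∈C f∉D))

        -- Removing `D` from `C` loses every vertex of `sC ─ W`, hence at least as many vertices as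
        -- edges.
        denseC─D : Dense (C ─ D)
        denseC─D = +-cancelʳ-≤ ∣ sC ─ W ∣ _ _ (begin
          ∣ spanned (C ─ D) ∣ + k + ∣ sC ─ W ∣
            ≡⟨ xy∙z≈xz∙y ∣ spanned (C ─ D) ∣ k _ ⟩
          ∣ spanned (C ─ D) ∣ + ∣ sC ─ W ∣ + k
            ≤⟨ +-monoˡ-≤ k (disjoint⇒∣p∣+∣q∣≤∣r∣ (spanned-mono G (p─q⊆p C D)) (p─q⊆p sC W) s[C─D]∩[sC─W]≡∅) ⟩
          ∣ sC ∣ + k
            ≡⟨ sym (proj₂ (proj₁ circuit)) ⟩
          ∣ C ∣
            ≤⟨ p⊆q∪r⇒∣p∣≤∣q∣+∣r∣ (C ─ D) D C⊆ ⟩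
          ∣ C ─ D ∣ + ∣ D ∣
            ≤⟨ +-monoʳ-≤ ∣ C ─ D ∣ ∣D∣≤ ⟩
          ∣ C ─ D ∣ + ∣ sC ─ W ∣ ∎)

      -- A maximal tight `Y` inside `B` absorbs, by `∪-tight`, the tight set that belongs to each
      -- edge outside `B`, so its span contains all ends of such edges. By `span-closed` it then
      -- contains the span of every circuit; every edge lies in a circuit and no vertex is isolated,
      -- so `Y` spans all `n` vertices.
      base-size : ∀ {B} → Base B → n + k ≤ suc ∣ B ∣
      base-size {B} base@(indep , _) = ≤-trans (+-monoˡ-≤ k n≤) (≤-trans tightY (s≤s (p⊆q⇒∣p∣≤∣q∣ Y⊆B)))
        where
        sparse : Sparse B
        sparse = independent⇒sparse indep

        -- An edge outside `B` supplies the first tight set; if there were none, `B` would contain a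
        -- circuit.
        x₀ : ∃[ x ] x ∉ B
        x₀ = decidable-stable (any? λ x → ¬? (x ∈? B)) λ all∈ →
          let C , circuit , _ = circuit-through (fromℕ< (proj₁ connected))
          in indep C circuit λ {x} _ → decidable-stable (x ∈? B) λ x∉B → all∈ (x , x∉B)

        TightIn : Subset m → Set
        TightIn Y = Y ⊆ B × Tight Y

        largest : ∃[ Y ] Maximal TightIn Y
        largest = let x , x∉B = x₀
                      Y , Y⊆B , tight , _ = tight-span base x x∉B
                  in maximal (λ Z → (Z ⊆? B) ×-dec (_ ≤? _)) Y (Y⊆B , tight)

        Y = proj₁ largest
        Y⊆B = proj₁ (proj₁ (proj₂ largest))
        tightY = proj₂ (proj₁ (proj₂ largest))

        outside : ∀ {x v} → x ∉ B → Incident v x → v ∈ spanned Y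
        outside {x} x∉B v~x =
          let Z , Z⊆B , tightZ , ends = tight-span base x x∉B
              Y∪Z≡Y = proj₂ (proj₂ largest) (Y ∪ Z)
                        (∪-⊆ Y⊆B Z⊆B , ∪-tight sparse Y⊆B tightY tightZ) (p⊆p∪q Z)
          in subst (λ X → _ ∈ spanned X) Y∪Z≡Y (spanned-mono G (q⊆p∪q Y Z) (ends v~x))

        n≤ : n ≤ ∣ spanned Y ∣
        n≤ = subst (_≤ ∣ spanned Y ∣) (∣⊤∣≡n n) (p⊆q⇒∣p∣≤∣q∣ {p = ⊤} λ {v} _ →
          let f , v~f = noIsolated v
              C , circuit , f∈C = circuit-through f
          in span-closed sparse Y⊆B tightY outside circuit (∈-spanned⁺ G f∈C v~f))

      -- The edges of `B` avoiding `W` form a set that is not dense and spans at most n - |W|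
      -- vertices, so there are fewer than n - |W| + k of them. By `base-size` at least |W| edges
      -- remain.
      base-meets : ∀ {B} → Base B → ∀ W → ∣ W ∣ ≤ ∣ B ∩ edgesMeeting W ∣
      base-meets {B} base W = +-cancelˡ-≤ (∣ sY ∣ + k) _ _ (begin
        ∣ sY ∣ + k + ∣ W ∣
          ≡⟨ xy∙z≈xz∙y ∣ sY ∣ k _ ⟩
        ∣ sY ∣ + ∣ W ∣ + k
          ≤⟨ +-monoˡ-≤ k (subst (∣ sY ∣ + ∣ W ∣ ≤_) (∣⊤∣≡n n) (disjoint⇒∣p∣+∣q∣≤∣r∣ ⊆⊤ ⊆⊤ disj)) ⟩
        n + k
          ≤⟨ base-size base ⟩
        suc ∣ B ∣
          ≤⟨ s≤s (p⊆q∪r⇒∣p∣≤∣q∣+∣r∣ Y M B⊆) ⟩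
        suc ∣ Y ∣ + ∣ M ∣
          ≤⟨ +-monoˡ-≤ ∣ M ∣ (≰⇒> (independent⇒sparse (proj₁ base) Y (p─q⊆p B _))) ⟩
        ∣ sY ∣ + k + ∣ M ∣ ∎)
        where
        open ≤-Reasoning
        Y = B ─ edgesMeeting W
        M = B ∩ edgesMeeting W
        sY = spanned Y

        disj : ∀ {v} → v ∈ sY → v ∉ W
        disj v∈sY v∈W = let f , f∈Y , v~f = ∈-spanned⁻ G v∈sY in
          x∈p─q⇒x∉q B (edgesMeeting W) f∈Y (∈-edgesMeeting⁺ G v~f v∈W)

        B⊆ : B ⊆ Y ∪ M
        B⊆ {f} f∈B with f ∈? edgesMeeting W
        ... | yes f∈ = x∈p∪q⁺ (inj₂ (x∈p∩q⁺ (f∈B , f∈)))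
        ... | no f∉  = x∈p∪q⁺ (inj₁ (x∈p∧x∉q⇒x∈p─q f∈B f∉))

    -- No independent set has more than n + k - 1 edges, so a sparse set of this size cannot be
    -- enlarged.
    sparse⇒base : ∀ {B} → Sparse B → n + k ≤ suc ∣ B ∣ → Base B
    sparse⇒base {B} sparse size = sparse⇒independent sparse , λ Y indep B⊆Y →
      ⊆-antisym (⊆∧∣q∣≤∣p∣⇒q⊆p B⊆Y (s≤s⁻¹ (≤-trans (≰⇒> (independent⇒sparse indep Y ⊆-refl))
        (≤-trans (+-monoˡ-≤ k (∣p∣≤n (spanned Y))) size)))) B⊆Y

-- Walks and cycles

module _ {G : Graph n m} where
  open import Data.List.Membership.DecPropositional (_≟_ {n}) using () renaming (_∈?_ to _∈ₗ?_)
  open Graph G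

  Joins-sym : ∀ {f u v} → Joins f u v → Joins f v u
  Joins-sym (inj₁ p) = inj₂ p
  Joins-sym (inj₂ p) = inj₁ p

  Joins⇒Incidentˡ : ∀ {f u v} → Joins f u v → Incident u f
  Joins⇒Incidentˡ (inj₁ (p , _)) = inj₁ p
  Joins⇒Incidentˡ (inj₂ (_ , p)) = inj₂ p

  Joins⇒Incidentʳ : ∀ {f u v} → Joins f u v → Incident v f
  Joins⇒Incidentʳ = Joins⇒Incidentˡ ∘ Joins-sym

  Joins-ends : ∀ {f u v w} → Joins f u v → Incident w f → w ≡ u ⊎ w ≡ v
  Joins-ends (inj₁ (refl , refl)) (inj₁ refl) = inj₁ refl
  Joins-ends (inj₁ (refl , refl)) (inj₂ refl) = inj₂ refl
  Joins-ends (inj₂ (refl , refl)) (inj₁ refl) = inj₂ refl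
  Joins-ends (inj₂ (refl , refl)) (inj₂ refl) = inj₁ refl

  Joins-loop : ∀ {f v} → Joins f v v → Loop f
  Joins-loop (inj₁ (p , q)) = trans p (sym q)
  Joins-loop (inj₂ (p , q)) = trans p (sym q)

  Loop-joins : ∀ {f u v} → Loop f → Joins f u v → v ≡ u
  Loop-joins loop (inj₁ (refl , refl)) = sym loop
  Loop-joins loop (inj₂ (refl , refl)) = loop

  Incident⇒Joins : ∀ {f v} → Incident v f → ∃[ w ] Joins f v w
  Incident⇒Joins (inj₁ p) = _ , inj₁ (p , refl)
  Incident⇒Joins (inj₂ p) = _ , inj₂ (refl , p)

  incident-∈V : ∀ (H : Subgraph G) {f v} → f ∈ E H → Incident v f → v ∈ V H
  incident-∈V H f∈ (inj₁ refl) = proj₁ (closed H _ f∈)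
  incident-∈V H f∈ (inj₂ refl) = proj₂ (closed H _ f∈)

  start-∈V : ∀ {H : Subgraph G} {u v} → Walk H u v → u ∈ V H
  start-∈V (nil v∈)                = v∈
  start-∈V {H} (cons f f∈ joins _) = incident-∈V H f∈ (Joins⇒Incidentˡ joins)

  end-∈V : ∀ {H : Subgraph G} {u v} → Walk H u v → v ∈ V H
  end-∈V (nil v∈)       = v∈
  end-∈V (cons _ _ _ p) = end-∈V p

  infixr 5 _++ʷ_

  _++ʷ_ : ∀ {H : Subgraph G} {u v w} → Walk H u v → Walk H v w → Walk H u w
  nil _              ++ʷ q = q
  cons f f∈ joins p  ++ʷ q = cons f f∈ joins (p ++ʷ q)

  reverseʷ : ∀ {H : Subgraph G} {u v} → Walk H u v → Walk H v u
  reverseʷ (nil v∈) = nil v∈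
  reverseʷ {H} (cons f f∈ joins p) =
    reverseʷ p ++ʷ cons f f∈ (Joins-sym joins) (nil (incident-∈V H f∈ (Joins⇒Incidentˡ joins)))

  walkEdges⊆E : ∀ {H : Subgraph G} {u v f} (p : Walk H u v) → f ∈ₗ walkEdges p → f ∈ E H
  walkEdges⊆E (cons f f∈ _ _) (here refl) = f∈
  walkEdges⊆E (cons _ _ _ p)  (there f∈p) = walkEdges⊆E p f∈p

  -- Walks in different subgraphs have different types; being a cycle depends only on these two
  -- lists, so it passes from one walk to the other.
  record SameTrace {H H′ : Subgraph G} {u v} (p : Walk H u v) (q : Walk H′ u v) : Set where
    constructor _&_
    field
      edges≡   : walkEdges q ≡ walkEdges p
      sources≡ : walkSources q ≡ walkSources p

  transport : ∀ {H H′ : Subgraph G} {u v} (p : Walk H u v) → (∀ {f} → f ∈ₗ walkEdges p → f ∈ E H′) →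
              v ∈ V H′ → ∃[ q ] SameTrace {H} {H′} p q
  transport (nil _) _ v∈ = nil v∈ , (refl & refl)
  transport (cons f _ joins p) edges v∈ =
    let q , (es & ss) = transport p (edges ∘ there) v∈
    in cons f (edges (here refl)) joins q , (cong (_ ∷_) es & cong (_ ∷_) ss)

  SameTrace⇒IsCycle : ∀ {H H′ : Subgraph G} {v} {p : Walk H v v} {q : Walk H′ v v} →
                      SameTrace p q → IsCycle p → IsCycle q
  SameTrace⇒IsCycle (es & ss) (ne , ue , us) =
    (λ eq → ne (trans (sym es) eq)) , subst Unique (sym es) ue , subst Unique (sym ss) us

  ⊑-walk : ∀ {H H′ : Subgraph G} {u v} → H ⊑ H′ → Walk H u v → Walk H′ u v
  ⊑-walk (V⊆ , E⊆) p = proj₁ (transport p (E⊆ ∘ walkEdges⊆E p) (V⊆ (end-∈V p)))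

  ⊑-acyclic : ∀ {H H′ : Subgraph G} → H ⊑ H′ → Acyclic H′ → Acyclic H
  ⊑-acyclic (V⊆ , E⊆) acyclic v p cycle =
    let q , same = transport p (E⊆ ∘ walkEdges⊆E p) (V⊆ (end-∈V p))
    in acyclic v q (SameTrace⇒IsCycle same cycle)

  -- Unlike walkSources, includes the last vertex.
  vertices : ∀ {H : Subgraph G} {u v} → Walk H u v → List (Fin n)
  vertices (nil {v} _)        = v ∷ []
  vertices (cons {u} _ _ _ p) = u ∷ vertices p

  IsPath : ∀ {H : Subgraph G} {u v} → Walk H u v → Set
  IsPath p = Unique (vertices p)

  ∉⇒All≢ : ∀ {a} {A : Set a} {x : A} {xs} → ¬ (x ∈ₗ xs) → All (x ≢_) xs
  ∉⇒All≢ = ¬Any⇒All¬ _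

  All≢⇒∉ : ∀ {a} {A : Set a} {x : A} {xs} → All (x ≢_) xs → ¬ (x ∈ₗ xs)
  All≢⇒∉ = All¬⇒¬Any

  walkSources⊆vertices : ∀ {H : Subgraph G} {u v x} (p : Walk H u v) → x ∈ₗ walkSources p → x ∈ₗ vertices p
  walkSources⊆vertices (cons _ _ _ p) (here eq)  = here eq
  walkSources⊆vertices (cons _ _ _ p) (there x∈) = there (walkSources⊆vertices p x∈)

  end∈vertices : ∀ {H : Subgraph G} {u v} (p : Walk H u v) → v ∈ₗ vertices p
  end∈vertices (nil _)        = here refl
  end∈vertices (cons _ _ _ p) = there (end∈vertices p)

  start∈vertices : ∀ {H : Subgraph G} {u v} (p : Walk H u v) → u ∈ₗ vertices p
  start∈vertices (nil _)        = here refl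
  start∈vertices (cons _ _ _ p) = here refl

  incident∈vertices : ∀ {H : Subgraph G} {u v f x} (p : Walk H u v) → f ∈ₗ walkEdges p → Incident x f → x ∈ₗ vertices p
  incident∈vertices (cons f _ joins p) (here refl) x~f with Joins-ends joins x~f
  ... | inj₁ refl = here refl
  ... | inj₂ refl = there (start∈vertices p)
  incident∈vertices (cons _ _ _ p) (there f∈) x~f = there (incident∈vertices p f∈ x~f)

  path⇒uniqueEdges : ∀ {H : Subgraph G} {u v} (p : Walk H u v) → IsPath p → Unique (walkEdges p)
  path⇒uniqueEdges (nil _) _ = []
  path⇒uniqueEdges (cons f _ joins p) (u∉ ∷ path) =
    ∉⇒All≢ (λ f∈p → All≢⇒∉ u∉ (incident∈vertices p f∈p (Joins⇒Incidentˡ joins))) ∷ path⇒uniqueEdges p path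

  path⇒uniqueSources : ∀ {H : Subgraph G} {u v} (p : Walk H u v) → IsPath p → Unique (walkSources p)
  path⇒uniqueSources (nil _) _ = []
  path⇒uniqueSources (cons _ _ _ p) (u∉ ∷ path) =
    ∉⇒All≢ (All≢⇒∉ u∉ ∘ walkSources⊆vertices p) ∷ path⇒uniqueSources p path

  path⇒end∉sources : ∀ {H : Subgraph G} {u v} (p : Walk H u v) → IsPath p → ¬ (v ∈ₗ walkSources p)
  path⇒end∉sources (cons _ _ _ p) (u∉ ∷ path) (here refl) = All≢⇒∉ u∉ (end∈vertices p)
  path⇒end∉sources (cons _ _ _ p) (u∉ ∷ path) (there v∈)  = path⇒end∉sources p path v∈

  initial-segment : ∀ {H : Subgraph G} {u w y} (p : Walk H u w) → IsPath p → y ∈ₗ vertices p →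
    ∃[ q ] (IsPath {H} {u} {y} q × (∀ {x} → x ∈ₗ vertices q → x ∈ₗ vertices p)
            × (∀ {f} → f ∈ₗ walkEdges q → f ∈ₗ walkEdges p))
  initial-segment (nil v∈) path (here refl) = nil v∈ , path , (λ x → x) , (λ f → f)
  initial-segment p@(cons _ _ _ _) path (here refl) =
    nil (start-∈V p) , [] ∷ [] , (λ { (here eq) → here eq }) , λ ()
  initial-segment (cons f f∈ joins p) (u∉ ∷ path) (there y∈) =
    let q , qpath , vs , es = initial-segment p path y∈
    in cons f f∈ joins q , ∉⇒All≢ (All≢⇒∉ u∉ ∘ vs) ∷ qpath
       , (λ { (here eq) → here eq ; (there x) → there (vs x) })
       , (λ { (here eq) → here eq ; (there x) → there (es x) })

  -- The edge `g` closes the initial segment of `p` from `u` to `y`. If `y` is `u`, the segment is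
  -- trivial and the cycle is the loop `g`.
  close-path : ∀ {H : Subgraph G} {u w y g} (p : Walk H u w) → IsPath p →
               g ∈ E H → Joins g y u → ¬ (g ∈ₗ walkEdges p) → y ∈ₗ vertices p → ¬ Acyclic H
  close-path {g = g} p path g∈ joins g∉p y∈p acyclic =
    let q , qpath , _ , es = initial-segment p path y∈p
    in acyclic _ (cons g g∈ joins q)
         ( (λ ()) , ∉⇒All≢ (g∉p ∘ es) ∷ path⇒uniqueEdges q qpath
         , ∉⇒All≢ (path⇒end∉sources q qpath) ∷ path⇒uniqueSources q qpath )

  leafAt? : ∀ (H : Subgraph G) v f → Dec (LeafAt H v f)
  leafAt? H v f = (v ∈? V H) ×-dec (f ∈? E H) ×-dec incident? v f ×-dec ¬? (end₁ f ≟ end₂ f)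
    ×-dec all? λ g → (g ∈? E H) →-dec incident? v g →-dec (g ≟ f)

  -- A path is extended backwards, from its first vertex, until it meets itself.
  leafless⇒cyclic : ∀ {H : Subgraph G} → (∀ v f → ¬ LeafAt H v f) → Nonempty (E H) → ¬ Acyclic H
  leafless⇒cyclic {H} leafless (f , f∈) acyclic =
    -- The search starts with the trivial path at the second end of `f` and with `f` as the next
    -- edge `g`. Every vertex outside `S` is on the path, so each new vertex `y` comes from `S` and
    -- is removed from it.
    go ⊤ (⊂-wellFounded ⊤) (nil (proj₂ (closed H f f∈))) (contradiction ∈⊤)
      ([] ∷ []) f∈ (inj₁ (refl , refl)) λ ()
    where
    go : ∀ S → Acc _⊂_ S → ∀ {u w y g} (p : Walk H u w) → (∀ {x} → x ∉ S → x ∈ₗ vertices p) →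
      IsPath p → g ∈ E H → Joins g y u → ¬ (g ∈ₗ walkEdges p) → ⊥ᵉ
    go S (acc rec) {y = y} {g} p cover path g∈ joins g∉p with y ∈ₗ? vertices p
    ... | yes y∈p = close-path p path g∈ joins g∉p y∈p acyclic
    ... | no y∉p with any? (λ h → (h ∈? E H) ×-dec incident? y h ×-dec ¬? (h ≟ g))
    ...   | no none = leafless y g
              -- With no edge other than `g` at `y`, the vertex `y` is a leaf; `g` is no loop
              -- because `u` is on the path and `y` is not.
              ( incident-∈V H g∈ (Joins⇒Incidentˡ joins) , g∈ , Joins⇒Incidentˡ joins
              , (λ loop → y∉p (subst (_∈ₗ vertices p) (Loop-joins loop joins) (start∈vertices p)))
              , λ h h∈ y~h → decidable-stable (h ≟ g) λ h≢g → none (h , h∈ , y~h , h≢g) )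
    ...   | yes (h , h∈ , y~h , h≢g) =
              go (S - y) (rec (x∈p⇒p-x⊂p y∈S)) (cons g g∈ joins p) cover′ (∉⇒All≢ y∉p ∷ path)
                h∈ (Joins-sym (proj₂ (Incident⇒Joins y~h)))
                λ { (here h≡g) → h≢g h≡g ; (there h∈p) → y∉p (incident∈vertices p h∈p y~h) }
      where
      y∈S : y ∈ S
      y∈S = decidable-stable (y ∈? S) (y∉p ∘ cover)

      cover′ : ∀ {x} → x ∉ S - y → x ∈ₗ y ∷ vertices p
      cover′ {x} x∉ with x ≟ y
      ... | yes x≡y = here x≡y
      ... | no x≢y  = there (cover λ x∈S → x∉ (x∈p∧x≢y⇒x∈p-y x∈S x≢y))

  -- Deleting leaves

  deleteLeaf : ∀ (H : Subgraph G) {v f} → LeafAt H v f → Subgraph G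
  deleteLeaf H {v} {f} (_ , _ , _ , _ , only) = record
    { V = V H - v
    ; E = E H - f
    ; closed = λ g g∈ → keep g∈ (inj₁ refl) , keep g∈ (inj₂ refl)
    }
    where
    keep : ∀ {g x} → g ∈ E H - f → Incident x g → x ∈ V H - v
    keep {g} {x} g∈ x~g = x∈p∧x≢y⇒x∈p-y (incident-∈V H g∈E x~g) λ { refl →
        x∈p-y⇒x≢y (E H) g∈ (only g g∈E x~g) }
      where g∈E = p─q⊆p (E H) ⁅ f ⁆ g∈

  -- Deleting a leaf removes one edge and one vertex and leaves its neighbour. When no leaf is left,
  -- `leafless⇒cyclic` shows that no edge is left, while some vertex remains.
  acyclic⇒∣E∣<∣V∣ : ∀ (H : Subgraph G) → Acyclic H → Nonempty (V H) → ∣ E H ∣ < ∣ V H ∣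
  acyclic⇒∣E∣<∣V∣ H = go H (⊂-wellFounded (E H))
    where
    go : ∀ H → Acc _⊂_ (E H) → Acyclic H → Nonempty (V H) → ∣ E H ∣ < ∣ V H ∣
    go H (acc rec) acyclic (x , x∈) with any? (λ v → any? (leafAt? H v))
    ... | yes (v , f , leaf@(v∈ , f∈ , v~f , ¬loop , _)) = begin-strict
            ∣ E H ∣          ≤⟨ ∣p∣≤1+∣p-x∣ (E H) f ⟩
            suc ∣ E H - f ∣  ≤⟨ go H′ (rec (x∈p⇒p-x⊂p f∈)) (⊑-acyclic H′⊑H acyclic) (proj₁ other , other∈) ⟩
            ∣ V H - v ∣      <⟨ x∈p⇒∣p-x∣<∣p∣ v∈ ⟩
            ∣ V H ∣          ∎
      where
      open ≤-Reasoning
      H′ = deleteLeaf H leaf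
      H′⊑H : H′ ⊑ H
      H′⊑H = p─q⊆p (V H) ⁅ v ⁆ , p─q⊆p (E H) ⁅ f ⁆
      other = Incident⇒Joins v~f
      other∈ : proj₁ other ∈ V H - v
      other∈ = x∈p∧x≢y⇒x∈p-y (incident-∈V H f∈ (Joins⇒Incidentʳ (proj₂ other)))
                 λ eq → ¬loop (Joins-loop (subst (Joins f v) eq (proj₂ other)))
    ... | no leafless with nonempty? (E H)
    ...   | yes E≢∅ = contradiction acyclic (leafless⇒cyclic (λ v f leaf → leafless (v , f , leaf)) E≢∅)
    ...   | no E≡∅ = ≤-trans (s≤s (≤-reflexive (trans (cong ∣_∣ (Empty-unique E≡∅)) (∣⊥∣≡0 m))))
                      (≤-trans (≤-reflexive (sym (∣⁅x⁆∣≡1 x))) (p⊆q⇒∣p∣≤∣q∣ λ y∈ → subst (_∈ V H) (sym (x∈⁅y⁆⇒x≡y x y∈)) x∈))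

  -- A walk passing through the leaf `v` in its interior would have to enter and leave by `f`,
  -- repeating an edge.
  leaf-in-walk⇒end : ∀ {H : Subgraph G} {v f a b} → LeafAt H v f → (p : Walk H a b) → Unique (walkEdges p) →
                     f ∈ₗ walkEdges p → a ≡ v ⊎ b ≡ v
  leaf-in-walk⇒end leaf@(_ , _ , v~f , _ , only) (cons f f∈ joins p) (f∉p ∷ unique) (here refl)
    with Joins-ends joins v~f
  ... | inj₁ refl = inj₁ refl
  ... | inj₂ refl with p
  ...   | nil _ = inj₂ refl
  ...   | cons g g∈ joins′ _ =
          contradiction (here (sym (only g g∈ (Joins⇒Incidentˡ joins′)))) (All≢⇒∉ f∉p)
  leaf-in-walk⇒end leaf@(_ , _ , _ , _ , only) (cons g g∈ joins p) (g∉p ∷ unique) (there f∈p)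
    with leaf-in-walk⇒end leaf p unique f∈p
  ... | inj₁ refl = contradiction (subst (_∈ₗ walkEdges p) (sym (only g g∈ (Joins⇒Incidentʳ joins))) f∈p) (All≢⇒∉ g∉p)
  ... | inj₂ eq   = inj₂ eq

  last-edge : ∀ {H : Subgraph G} {u v} (p : Walk H u v) → u ≢ v → ∃[ g ] (g ∈ₗ walkEdges p × Incident v g)
  last-edge (nil _) u≢v = contradiction refl u≢v
  last-edge {v = v} (cons {v = w} g _ joins p) u≢v with w ≟ v
  ... | yes refl = g , here refl , Joins⇒Incidentʳ joins
  ... | no w≢v   = let h , h∈ , v~h = last-edge p w≢v in h , there h∈ , v~h

  leaf∉cycle : ∀ {H : Subgraph G} {v f x} → LeafAt H v f → (p : Walk H x x) → IsCycle p →
               x ≢ v × ¬ (f ∈ₗ walkEdges p)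
  leaf∉cycle {H} {v} {f} {x} leaf@(_ , _ , _ , ¬loop , only) p (ne , unique , _) = x≢v , λ f∈p →
      [ x≢v , x≢v ]′ (leaf-in-walk⇒end leaf p unique f∈p)
    where
    based-at-v : (q : Walk H v v) → walkEdges q ≢ [] → ¬ Unique (walkEdges q)
    based-at-v (nil _) ne _ = ne refl
    -- The first edge is `f` and leads away from `v`, since it is no loop; the walk can return to
    -- `v` only by `f` again.
    based-at-v (cons g g∈ joins q) _ (g∉q ∷ _) with only g g∈ (Joins⇒Incidentˡ joins)
    ... | refl with last-edge q (λ { refl → ¬loop (Joins-loop joins) })
    ...   | h , h∈ , v~h = All≢⇒∉ g∉q (subst (_∈ₗ walkEdges q) (only h (walkEdges⊆E q h∈) v~h) h∈)

    x≢v : x ≢ v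
    x≢v refl = based-at-v p ne unique

  -- Each visit to `v` goes along `f` and straight back, and can be cut out. `H′` is given by
  -- inclusions so that the lemma also applies after `e` has been removed.
  avoid-leaf : ∀ {H H′ : Subgraph G} {v f a b} → LeafAt H v f → V H - v ⊆ V H′ → E H - f ⊆ E H′ →
               a ≢ v → b ≢ v → Walk H a b → Walk H′ a b
  avoid-leaf leaf V⊆ E⊆ a≢v b≢v (nil a∈) = nil (V⊆ (x∈p∧x≢y⇒x∈p-y a∈ a≢v))
  avoid-leaf {v = v} {f} leaf@(_ , _ , v~f , ¬loop , only) V⊆ E⊆ a≢v b≢v (cons {v = c} g g∈ joins p) with c ≟ v
  ... | no c≢v = cons g (E⊆ (x∈p∧x≢y⇒x∈p-y g∈ λ { refl →
                   [ a≢v ∘ sym , c≢v ∘ sym ]′ (Joins-ends joins v~f) })) joins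
                   (avoid-leaf leaf V⊆ E⊆ c≢v b≢v p)
  ... | yes refl with only g g∈ (Joins⇒Incidentʳ joins) | p
  ...   | refl | nil _ = contradiction refl b≢v
  ...   | refl | cons h h∈ joins′ q with only h h∈ (Joins⇒Incidentˡ joins′)
  ...     | refl with Joins-ends joins (Joins⇒Incidentʳ joins′)
  ...       | inj₁ refl = avoid-leaf leaf V⊆ E⊆ a≢v b≢v q
  ...       | inj₂ refl = contradiction (Joins-loop joins′) ¬loop

  -- At the moment when e is deleted its end v is a leaf.  Going back through the
  -- earlier deletions, walks of A ∖ e between surviving vertices and cycles of A persist.
  record Dangling (H : Subgraph G) (e : Fin m) : Set where
    field
      {v z}     : Fin n
      v∈        : v ∈ V H
      z∈        : z ∈ V H
      joins     : Joins e v z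
      separated : ¬ Walk (H ∖ e) v z
      cyclefree : ∀ {x} (p : Walk H x x) → IsCycle p → ¬ Walk (H ∖ e) v x

  -- Without `e` the leaf `v` has no edge, so only the trivial walk starts there. It does not reach
  -- `z`, as `e` is no loop, nor the start of a cycle, by `leaf∉cycle`.
  leaf⇒dangling : ∀ {H : Subgraph G} {e v} → LeafAt H v e → Dangling H e
  leaf⇒dangling {H} {e} {v} leaf@(v∈ , e∈ , v~e , ¬loop , only) =
    let z , joins = Incident⇒Joins v~e in record
    { v∈        = v∈
    ; z∈        = incident-∈V H e∈ (Joins⇒Incidentʳ joins)
    ; joins     = joins
    ; separated = λ p → ¬loop (Joins-loop (subst (Joins e v) (stuck p) joins))
    ; cyclefree = λ p cycle q → proj₁ (leaf∉cycle leaf p cycle) (stuck q)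
    }
    where
    stuck : ∀ {x} → Walk (H ∖ e) v x → x ≡ v
    stuck (nil _) = refl
    stuck (cons g g∈ joins _) = contradiction
      (only g (p─q⊆p (E H) ⁅ e ⁆ g∈) (Joins⇒Incidentˡ joins)) (x∈p-y⇒x≢y (E H) g∈)

  dangling : ∀ {H N : Subgraph G} {e} → Star LeafDeletion H N → e ∈ E H → e ∉ E N → Dangling H e
  dangling ε e∈ e∉ = contradiction e∈ e∉
  dangling {H} {e = e} (_◅_ {j = H′} (w , f , leaf@(w∈ , f∈ , w~f , ¬loop , only) , V≡ , E≡) rest) e∈ e∉ with e ≟ f
  ... | yes refl = leaf⇒dangling leaf
  ... | no e≢f = record
      { v∈        = p─q⊆p (V H) ⁅ w ⁆ v∈′
      ; z∈        = p─q⊆p (V H) ⁅ w ⁆ z∈′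
      ; joins     = D.joins
      -- Both `v` and `z` survive the deletion of `w`, so a walk between them can be rerouted around
      -- `w` into the smaller subgraph.
      ; separated = λ p → D.separated (shorten (x∈p-y⇒x≢y (V H) v∈′) (x∈p-y⇒x≢y (V H) z∈′) p)
      ; cyclefree = λ p cycle q →
          let x≢w , f∉p = leaf∉cycle leaf p cycle
              p′ , same = transport p (λ g∈p → subst (_ ∈_) (sym E≡)
                            (x∈p∧x≢y⇒x∈p-y (walkEdges⊆E p g∈p) λ { refl → f∉p g∈p }))
                            (subst (_ ∈_) (sym V≡) (x∈p∧x≢y⇒x∈p-y (end-∈V p) x≢w))
          in D.cyclefree p′ (SameTrace⇒IsCycle same cycle) (shorten (x∈p-y⇒x≢y (V H) v∈′) x≢w q)
      }
    where
    module D = Dangling (dangling rest (subst (e ∈_) (sym E≡) (x∈p∧x≢y⇒x∈p-y e∈ e≢f)) e∉)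

    v∈′ : D.v ∈ V H - w
    v∈′ = subst (D.v ∈_) V≡ D.v∈

    z∈′ : D.z ∈ V H - w
    z∈′ = subst (D.z ∈_) V≡ D.z∈

    leaf∖e : LeafAt (H ∖ e) w f
    leaf∖e = w∈ , x∈p∧x≢y⇒x∈p-y f∈ (e≢f ∘ sym) , w~f , ¬loop , λ g g∈ → only g (p─q⊆p (E H) ⁅ e ⁆ g∈)

    shorten : ∀ {a b} → a ≢ w → b ≢ w → Walk (H ∖ e) a b → Walk (H′ ∖ e) a b
    shorten = avoid-leaf leaf∖e (λ x∈ → subst (_ ∈_) (sym V≡) x∈)
      (λ g∈ → subst (λ F → _ ∈ F - e) (sym E≡) (subst (_ ∈_) (p─x─y≡p─y─x (E H) e f) g∈))

  -- Components

  Closed : Subgraph G → Subset n → Set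
  Closed H R = ∀ {f x y} → f ∈ E H → Joins f x y → x ∈ R → y ∈ R

  closed-walk : ∀ {H : Subgraph G} {R x y} → Closed H R → x ∈ R → Walk H x y → y ∈ R
  closed-walk closedR x∈ (nil _)             = x∈
  closed-walk closedR x∈ (cons f f∈ joins p) = closed-walk closedR (closedR f∈ joins x∈) p

  -- `R` grows along edges that leave it, each new vertex coming with a walk from `v`; finiteness
  -- stops this at a closed set.
  reachable : ∀ (H : Subgraph G) {v} → v ∈ V H →
              ∃[ R ] (v ∈ R × (∀ {x} → x ∈ R → Walk H v x) × Closed H R)
  reachable H {v} v∈ = go ⁅ v ⁆ (⊃-wellFounded ⁅ v ⁆) (x∈⁅x⁆ v)
      λ x∈ → subst (Walk H v) (sym (x∈⁅y⁆⇒x≡y v x∈)) (nil v∈)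
    where
    go : ∀ R → Acc _⊃_ R → v ∈ R → (∀ {x} → x ∈ R → Walk H v x) →
         ∃[ R ] (v ∈ R × (∀ {x} → x ∈ R → Walk H v x) × Closed H R)
    go R (acc rec) v∈R walks
      with any? (λ f → any? λ x → any? λ y → (f ∈? E H) ×-dec joins? f x y ×-dec (x ∈? R) ×-dec ¬? (y ∈? R))
      where
      joins? : ∀ f x y → Dec (Joins f x y)
      joins? f x y = ((end₁ f ≟ x) ×-dec (end₂ f ≟ y)) ⊎-dec ((end₁ f ≟ y) ×-dec (end₂ f ≟ x))
    ... | no none = R , v∈R , walks , λ {f} {x} {y} f∈ joins x∈R →
            decidable-stable (y ∈? R) λ y∉R → none (f , x , y , f∈ , joins , x∈R , y∉R)
    ... | yes (f , x , y , f∈ , joins , x∈R , y∉R) =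
            go (R ∪ ⁅ y ⁆) (rec (p⊆p∪q ⁅ y ⁆ , y , q⊆p∪q R ⁅ y ⁆ (x∈⁅x⁆ y) , y∉R)) (p⊆p∪q ⁅ y ⁆ v∈R) walks′
      where
      walks′ : ∀ {x} → x ∈ R ∪ ⁅ y ⁆ → Walk H v x
      walks′ z∈ with x∈p∪q⁻ R ⁅ y ⁆ z∈
      ... | inj₁ z∈R = walks z∈R
      ... | inj₂ z∈y with x∈⁅y⁆⇒x≡y y z∈y
      ...   | refl = walks x∈R ++ʷ cons f f∈ joins (nil (incident-∈V H f∈ (Joins⇒Incidentʳ joins)))

  record Component (H : Subgraph G) (v : Fin n) : Set where
    field
      C           : Subgraph G
      isComponent : IsComponent C H
      v∈          : v ∈ V C
      closedC     : Closed H (V C)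
      edgesC      : ∀ {f x} → f ∈ E H → Incident x f → x ∈ V C → f ∈ E C

    ⊑-component : ∀ {D} → D ⊑ H → Connected D → v ∈ V D → D ⊑ C
    ⊑-component {D} D⊑H (_ , walks) v∈D = VD⊆ , λ f∈ →
        edgesC (proj₂ D⊑H f∈) (inj₁ refl) (VD⊆ (proj₁ (closed D _ f∈)))
      where
      VD⊆ : V D ⊆ V C
      VD⊆ x∈D = closed-walk {H} closedC v∈ (⊑-walk D⊑H (walks _ _ v∈D x∈D))

    unique : ∀ {D} → IsComponent D H → v ∈ V D → C ≈ D
    unique {D} (D⊑H , connected , max) v∈D =
      max C (proj₁ isComponent) (proj₁ (proj₂ isComponent)) (⊑-component {D} D⊑H connected v∈D)

  component : ∀ (H : Subgraph G) {v} → v ∈ V H → Component H v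
  component H {v} v∈H = record
    { C = C ; isComponent = C⊑H , C-connected , C-max ; v∈ = v∈R ; closedC = closedR
    ; edgesC = λ f∈ x~f x∈R → x∈p∩q⁺ (f∈ , ∈-edgesMeeting⁺ G x~f x∈R) }
    where
    reach = reachable H v∈H
    R = proj₁ reach
    v∈R = proj₁ (proj₂ reach)
    walks = proj₁ (proj₂ (proj₂ reach))

    closedR : Closed H R
    closedR = proj₂ (proj₂ (proj₂ reach))

    end∈R : ∀ {f x} → f ∈ E H ∩ edgesMeeting R → Incident x f → x ∈ R
    end∈R {f} f∈ x~f with x∈p∩q⁻ (E H) _ f∈
    ... | f∈H , f∈M with ∈-edgesMeeting⁻ G f∈M
    ...   | y , y~f , y∈R with Incident⇒Joins y~f
    ...     | z , joins with Joins-ends joins x~f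
    ...       | inj₁ refl = y∈R
    ...       | inj₂ refl = closedR f∈H joins y∈R

    C : Subgraph G
    C = record { V = R ; E = E H ∩ edgesMeeting R
               ; closed = λ f f∈ → end∈R f∈ (inj₁ refl) , end∈R f∈ (inj₂ refl) }

    C⊑H : C ⊑ H
    C⊑H = end-∈V ∘ walks , p∩q⊆p (E H) _

    inC : ∀ {x y} → x ∈ R → Walk H x y → Walk C x y
    inC x∈ (nil _)             = nil x∈
    inC x∈ (cons f f∈ joins p) =
      cons f (x∈p∩q⁺ (f∈ , ∈-edgesMeeting⁺ G (Joins⇒Incidentˡ joins) x∈)) joins (inC (closedR f∈ joins x∈) p)

    C-connected : Connected C
    C-connected = (v , v∈R) , λ x y x∈ y∈ → inC x∈ (reverseʷ (walks x∈) ++ʷ walks y∈)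

    C-max : ∀ D → D ⊑ H → Connected D → C ⊑ D → D ≈ C
    C-max D D⊑H (_ , Dwalks) (V⊆ , E⊆) = ⊆-antisym VD⊆ V⊆ , ⊆-antisym ED⊆ E⊆
      where
      VD⊆ : V D ⊆ R
      VD⊆ x∈ = closed-walk {H} closedR v∈R (⊑-walk D⊑H (Dwalks _ _ (V⊆ v∈R) x∈))
      ED⊆ : E D ⊆ E H ∩ edgesMeeting R
      ED⊆ f∈ = x∈p∩q⁺ (proj₂ D⊑H f∈ , ∈-edgesMeeting⁺ G (inj₁ refl) (VD⊆ (proj₁ (closed D _ f∈))))

  -- A given component agrees, by its maximality, with the one constructed around `x`, whose edges
  -- are known explicitly.
  component-edges : ∀ {H C : Subgraph G} → IsComponent C H → ∀ {f x} → f ∈ E H → Incident x f → x ∈ V C → f ∈ E C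
  component-edges {H} {C} isC@(C⊑H , _) {f} f∈ x~f x∈ = subst (f ∈_) (proj₂ (K.unique isC x∈))
      (K.edgesC f∈ x~f K.v∈)
    where module K = Component (component H (proj₁ C⊑H x∈))

  component-closed : ∀ {H C : Subgraph G} → IsComponent C H → Closed H (V C)
  component-closed {H} {C} isC f∈ joins x∈ =
    incident-∈V C (component-edges {H} {C} isC f∈ (Joins⇒Incidentˡ joins) x∈) (Joins⇒Incidentʳ joins)

  ≈-sym : ∀ {H H′ : Subgraph G} → H ≈ H′ → H′ ≈ H
  ≈-sym (V≡ , E≡) = sym V≡ , sym E≡

-- The fundamental cocircuit

module PendantTree (G : Graph n m) (k : ℕ) (1≤k : 1 ≤ k) where
  open Graph G
  open Matroid (MCircuit k G)
  open Count G k

  -- By `edgesAtT`, `e` is the only edge of `B` that can join `V T` to the rest of the graph.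
  module _ (connected : ConnectedMatroid) {B} (base : Base B) {e} (e∈B : e ∈ B)
           (T : Subgraph G) (T≢∅ : Nonempty (V T)) (acyclic : Acyclic T)
           (edgesAtT : ∀ {f x} → f ∈ B → f ≢ e → Incident x f → x ∈ V T → f ∈ E T) where

    cocircuit : Subset m
    cocircuit = ⁅ e ⁆ ∪ (∁ B ∩ edgesMeeting (V T))

    e∈cocircuit : e ∈ cocircuit
    e∈cocircuit = x∈p∪q⁺ (inj₁ (x∈⁅x⁆ e))

    ∈-cocircuit⁻ : ∀ {u} → u ∈ cocircuit → u ≡ e ⊎ (u ∉ B × u ∈ edgesMeeting (V T))
    ∈-cocircuit⁻ u∈ with x∈p∪q⁻ ⁅ e ⁆ _ u∈
    ... | inj₁ u∈e = inj₁ (x∈⁅y⁆⇒x≡y e u∈e)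
    ... | inj₂ u∈∩ = let u∈∁B , u∈M = x∈p∩q⁻ (∁ B) _ u∈∩ in inj₂ (x∈∁p⇒x∉p u∈∁B , u∈M)

    swap : Fin m → Subset m
    swap u = (B - e) ∪ ⁅ u ⁆

    ∈-swap⁻ : ∀ {u f} → f ∈ swap u → f ≡ u ⊎ (f ∈ B × f ≢ e)
    ∈-swap⁻ {u} f∈ with x∈p∪q⁻ (B - e) ⁅ u ⁆ f∈
    ... | inj₁ f∈B-e = inj₂ (p─q⊆p B ⁅ e ⁆ f∈B-e , x∈p-y⇒x≢y B f∈B-e)
    ... | inj₂ f∈u   = inj₁ (x∈⁅y⁆⇒x≡y u f∈u)

    -- Discarding from a dense set Z ∋ u everything that meets T loses at most as many edges
    -- as vertices, because the part of Z inside T is a forest; what is left is dense and inside B.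
    swap-sparse : ∀ {u} → u ∉ B → u ∈ edgesMeeting (V T) → Sparse (swap u)
    swap-sparse {u} u∉B u∈M Z Z⊆ dense = sparseB Z′ Z′⊆B (+-cancelʳ-≤ ∣ V F ∣ _ _ (begin
      ∣ spanned Z′ ∣ + k + ∣ V F ∣
        ≡⟨ xy∙z≈xz∙y ∣ spanned Z′ ∣ k _ ⟩
      ∣ spanned Z′ ∣ + ∣ V F ∣ + k
        ≤⟨ +-monoˡ-≤ k (disjoint⇒∣p∣+∣q∣≤∣r∣ (spanned-mono G (p─q⊆p Z M)) (p∩q⊆p (spanned Z) (V T)) disj) ⟩
      ∣ spanned Z ∣ + k
        ≤⟨ dense ⟩
      ∣ Z ∣
        ≤⟨ p⊆q∪r⇒∣p∣≤∣q∣+∣r∣ Z′ (⁅ u ⁆ ∪ E F) Z⊆′ ⟩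
      ∣ Z′ ∣ + ∣ ⁅ u ⁆ ∪ E F ∣
        ≤⟨ +-monoʳ-≤ ∣ Z′ ∣ (∣p∪q∣≤∣p∣+∣q∣ ⁅ u ⁆ (E F)) ⟩
      ∣ Z′ ∣ + (∣ ⁅ u ⁆ ∣ + ∣ E F ∣)
        ≡⟨ cong (λ c → ∣ Z′ ∣ + (c + ∣ E F ∣)) (∣⁅x⁆∣≡1 u) ⟩
      ∣ Z′ ∣ + suc ∣ E F ∣
        ≤⟨ +-monoʳ-≤ ∣ Z′ ∣ (acyclic⇒∣E∣<∣V∣ F (⊑-acyclic F⊑T acyclic) F≢∅) ⟩
      ∣ Z′ ∣ + ∣ V F ∣ ∎))
      where
      open ≤-Reasoning
      M  = edgesMeeting (V T)
      Z′ = Z ─ M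

      sparseB : Sparse B
      sparseB = independent⇒sparse 1≤k (proj₁ base)

      -- `F` is the part of `Z` inside `T`. Its vertices are cut down to the span of `Z`, so that
      -- they can be counted against |V(Z)|.
      F : Subgraph G
      F = record { V = spanned Z ∩ V T ; E = Z ∩ E T ; closed = λ f f∈ →
            let f∈Z , f∈T = x∈p∩q⁻ Z (E T) f∈ ; x∈ , y∈ = closed T f f∈T in
            x∈p∩q⁺ (∈-spanned⁺ G f∈Z (inj₁ refl) , x∈) , x∈p∩q⁺ (∈-spanned⁺ G f∈Z (inj₂ refl) , y∈) }

      F⊑T : F ⊑ T
      F⊑T = p∩q⊆q (spanned Z) (V T) , p∩q⊆q Z (E T)

      u∈Z : u ∈ Z
      u∈Z = decidable-stable (u ∈? Z) λ u∉Z → sparseB Z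
        (λ f∈Z → [ (λ { refl → contradiction f∈Z u∉Z }) , proj₁ ]′ (∈-swap⁻ (Z⊆ f∈Z))) dense

      -- As `u` has an end in `V T`, the forest `F` has a vertex and thus fewer edges than vertices;
      -- the difference pays for `u`.
      F≢∅ : Nonempty (V F)
      F≢∅ = let x , x~u , x∈T = ∈-edgesMeeting⁻ G u∈M in x , x∈p∩q⁺ (∈-spanned⁺ G u∈Z x~u , x∈T)

      Z′⊆B : Z′ ⊆ B
      Z′⊆B f∈ with ∈-swap⁻ (Z⊆ (p─q⊆p Z M f∈))
      ... | inj₁ refl      = contradiction u∈M (x∈p─q⇒x∉q Z M f∈)
      ... | inj₂ (f∈B , _) = f∈B

      disj : ∀ {x} → x ∈ spanned Z′ → x ∉ V F
      disj x∈ x∈F = let f , f∈ , x~f = ∈-spanned⁻ G x∈ in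
        x∈p─q⇒x∉q Z M f∈ (∈-edgesMeeting⁺ G x~f (proj₁ F⊑T x∈F))

      Z⊆′ : Z ⊆ Z′ ∪ (⁅ u ⁆ ∪ E F)
      Z⊆′ {f} f∈Z with f ∈? M
      ... | no f∉M = x∈p∪q⁺ (inj₁ (x∈p∧x∉q⇒x∈p─q f∈Z f∉M))
      ... | yes f∈M with ∈-swap⁻ (Z⊆ f∈Z)
      ...   | inj₁ refl = x∈p∪q⁺ (inj₂ (x∈p∪q⁺ (inj₁ (x∈⁅x⁆ u))))
      ...   | inj₂ (f∈B , f≢e) = let x , x~f , x∈T = ∈-edgesMeeting⁻ G f∈M in
                x∈p∪q⁺ (inj₂ (x∈p∪q⁺ (inj₂ (x∈p∩q⁺ (f∈Z , edgesAtT f∈B f≢e x~f x∈T)))))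

    swap-base : ∀ {u} → u ∉ B → u ∈ edgesMeeting (V T) → Base (swap u)
    swap-base {u} u∉B u∈M = sparse⇒base 1≤k (swap-sparse u∉B u∈M) (begin
      n + k                      ≤⟨ base-size 1≤k connected base ⟩
      suc ∣ B ∣                  ≤⟨ s≤s (∣p∣≤1+∣p-x∣ B e) ⟩
      suc (suc ∣ B - e ∣)        ≡⟨ cong (λ c → suc (c + ∣ B - e ∣)) (sym (∣⁅x⁆∣≡1 u)) ⟩
      suc (∣ ⁅ u ⁆ ∣ + ∣ B - e ∣) ≤⟨ s≤s (disjoint⇒∣p∣+∣q∣≤∣r∣ (q⊆p∪q (B - e) ⁅ u ⁆) (p⊆p∪q ⁅ u ⁆) disj) ⟩
      suc ∣ swap u ∣             ∎)
      where
      open ≤-Reasoning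
      disj : ∀ {f} → f ∈ ⁅ u ⁆ → f ∉ B - e
      disj f∈u f∈B-e with x∈⁅y⁆⇒x≡y u f∈u
      ... | refl = u∉B (p─q⊆p B ⁅ e ⁆ f∈B-e)

    exchange : ∀ {u} → u ∈ cocircuit → ∃[ B′ ] (Base B′ × (∀ {f} → f ∈ B′ → f ≡ u ⊎ (f ∈ B × f ≢ e)))
    exchange u∈ with ∈-cocircuit⁻ u∈
    ... | inj₂ (u∉B , u∈M) = swap _ , swap-base u∉B u∈M , ∈-swap⁻
    ... | inj₁ refl        = B , base , split
      where
      split : ∀ {f} → f ∈ B → f ≡ e ⊎ (f ∈ B × f ≢ e)
      split {f} f∈B with f ≟ e
      ... | yes f≡e = inj₁ f≡e
      ... | no f≢e  = inj₂ (f∈B , f≢e)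

    -- If `u` were missing from `Y`, the base obtained from `B` by exchanging `e` for `u` would
    -- avoid `Y`. This yields both the minimality and the uniqueness in `fundamental`.
    cocircuit⊆ : ∀ {Y} → ¬ Coindependent Y → (∀ {f} → f ∈ Y → f ∈ B → f ≡ e) → cocircuit ⊆ Y
    cocircuit⊆ {Y} dependent Y∩B {u} u∈ = decidable-stable (u ∈? Y) λ u∉Y →
      let B′ , base′ , B′⊆ = exchange u∈ in
      dependent (B′ , base′ , λ f∈Y → x∉p⇒x∈∁p λ f∈B′ →
        [ (λ { refl → u∉Y f∈Y }) , (λ (f∈B , f≢e) → f≢e (Y∩B f∈Y f∈B)) ]′ (B′⊆ f∈B′))

    cocircuit-codependent : ¬ Coindependent cocircuit
    cocircuit-codependent (B′ , base′ , ⊆∁B′) =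
      <⇒≱ (acyclic⇒∣E∣<∣V∣ T acyclic T≢∅) (≤-trans (base-meets 1≤k connected base′ (V T)) (p⊆q⇒∣p∣≤∣q∣ ⊆ET))
      where
      ⊆ET : B′ ∩ edgesMeeting (V T) ⊆ E T
      ⊆ET {f} f∈ =
        let f∈B′ , f∈M = x∈p∩q⁻ B′ _ f∈
            x , x~f , x∈T = ∈-edgesMeeting⁻ G f∈M
            f∉K = λ f∈K → x∈∁p⇒x∉p (⊆∁B′ f∈K) f∈B′
            f∈B = decidable-stable (f ∈? B) λ f∉B → f∉K (x∈p∪q⁺ (inj₂ (x∈p∩q⁺ (x∉p⇒x∈∁p f∉B , f∈M))))
        in edgesAtT f∈B (λ { refl → f∉K e∈cocircuit }) x~f x∈T

    fundamental : IsFundamentalCocircuit e B cocircuit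
    fundamental =
      (cocircuit-codependent , λ Y dependent Y⊆ → ⊆-antisym Y⊆ (cocircuit⊆ dependent (only-e ∘ Y⊆))) ,
      ⊆-antisym ∩⊆ ⊆∩ ,
      λ K′ (dependent , min) K′∩B → sym (min cocircuit cocircuit-codependent (cocircuit⊆ dependent
        λ f∈K′ f∈B → x∈⁅y⁆⇒x≡y e (subst (_ ∈_) K′∩B (x∈p∩q⁺ (f∈K′ , f∈B)))))
      where
      only-e : ∀ {f} → f ∈ cocircuit → f ∈ B → f ≡ e
      only-e f∈ f∈B = [ (λ eq → eq) , (λ (f∉B , _) → contradiction f∈B f∉B) ]′ (∈-cocircuit⁻ f∈)

      ∩⊆ : cocircuit ∩ B ⊆ ⁅ e ⁆
      ∩⊆ f∈ with x∈p∩q⁻ cocircuit B f∈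
      ... | f∈K , f∈B = subst (_∈ ⁅ e ⁆) (sym (only-e f∈K f∈B)) (x∈⁅x⁆ e)

      ⊆∩ : ⁅ e ⁆ ⊆ cocircuit ∩ B
      ⊆∩ f∈ with x∈⁅y⁆⇒x≡y e f∈
      ... | refl = x∈p∩q⁺ (e∈cocircuit , e∈B)

    -- With forests on both sides, at most |E(T)| + |E(T′)| + 1 edges of `B` meet the two vertex
    -- sets, fewer than |V(T)| + |V(T′)|. This contradicts `base-meets`.
    no-second-tree : ∀ (T′ : Subgraph G) → Nonempty (V T′) → (∀ {x} → x ∈ V T → x ∉ V T′) →
      (∀ {f x} → f ∈ B → f ≢ e → Incident x f → x ∈ V T′ → f ∈ E T′) → ¬ Acyclic T′
    no-second-tree T′ T′≢∅ disj edgesAtT′ acyclic′ = <⇒≱ (acyclic⇒∣E∣<∣V∣ T′ acyclic′ T′≢∅)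
      (+-cancelˡ-≤ ∣ V T ∣ _ _ (begin
      ∣ V T ∣ + ∣ V T′ ∣              ≤⟨ disjoint⇒∣p∣+∣q∣≤∣r∣ (p⊆p∪q (V T′)) (q⊆p∪q (V T) (V T′)) disj ⟩
      ∣ V T ∪ V T′ ∣                  ≤⟨ base-meets 1≤k connected base (V T ∪ V T′) ⟩
      ∣ B ∩ edgesMeeting _ ∣          ≤⟨ p⊆q∪r⇒∣p∣≤∣q∣+∣r∣ ⁅ e ⁆ (E T ∪ E T′) edges ⟩
      ∣ ⁅ e ⁆ ∣ + ∣ E T ∪ E T′ ∣      ≡⟨ cong (_+ ∣ E T ∪ E T′ ∣) (∣⁅x⁆∣≡1 e) ⟩
      suc ∣ E T ∪ E T′ ∣              ≤⟨ s≤s (∣p∪q∣≤∣p∣+∣q∣ (E T) (E T′)) ⟩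
      suc ∣ E T ∣ + ∣ E T′ ∣          ≤⟨ +-monoˡ-≤ ∣ E T′ ∣ (acyclic⇒∣E∣<∣V∣ T acyclic T≢∅) ⟩
      ∣ V T ∣ + ∣ E T′ ∣              ∎))
      where
      open ≤-Reasoning
      edges : B ∩ edgesMeeting (V T ∪ V T′) ⊆ ⁅ e ⁆ ∪ (E T ∪ E T′)
      edges {f} f∈ with x∈p∩q⁻ B _ f∈ | f ≟ e
      ... | _ | yes refl = x∈p∪q⁺ (inj₁ (x∈⁅x⁆ e))
      ... | f∈B , f∈M | no f≢e with ∈-edgesMeeting⁻ G f∈M
      ...   | x , x~f , x∈ with x∈p∪q⁻ (V T) (V T′) x∈
      ...     | inj₁ x∈T  = x∈p∪q⁺ (inj₂ (x∈p∪q⁺ (inj₁ (edgesAtT f∈B f≢e x~f x∈T))))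
      ...     | inj₂ x∈T′ = x∈p∪q⁺ (inj₂ (x∈p∪q⁺ (inj₂ (edgesAtT′ f∈B f≢e x~f x∈T′))))

-- The two components of A minus e and the fundamental cocircuit.

mainTheorem18 : ∀ {n m : ℕ} (G : Graph n m) (k : ℕ) → 1 ≤ k →
    let open Graph G
        open Matroid (MCircuit k G)
    in
    ConnectedMatroid →
    ∀ (B : Subset m) → Base B →
    ∀ (e : Fin m) → e ∈ B →
    ∀ (A : Subgraph G) → IsComponent A (G ⟨ B ⟩) → e ∈ E A →
    ∀ (N : Subgraph G) → IsKernel N A → e ∉ E N →
    ∃[ T ] ∃[ T′ ]
    ( IsComponent T (A ∖ e) × IsComponent T′ (A ∖ e) × ¬ (T ≈ T′)
    × (∀ C → IsComponent C (A ∖ e) → C ≈ T ⊎ C ≈ T′)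
    × IsTree T × ¬ IsTree T′
    × IsFundamentalCocircuit e B (⁅ e ⁆ ∪ (∁ B ∩ edgesMeeting (V T))) )
mainTheorem18 {n} {m} G k 1≤k connected B base e e∈B A A-component@(_ , (_ , A-walks) , _) e∈A N (deletions , _) e∉N =
    T , T′ , T-component , T′-component , (λ (V≡ , _) → T∌z (subst (z ∈_) (sym V≡) T′ᶜ.v∈)) , dichotomy ,
    (T-connected , T-acyclic) ,
    (λ (_ , T′-acyclic) → no-second-tree T T-nonempty T-acyclic edgesAtT T′ (z , T′ᶜ.v∈) disjoint edgesAtT′ T′-acyclic) ,
    fundamental T T-nonempty T-acyclic edgesAtT
  where
  open Graph G
  open Dangling (dangling deletions e∈A e∉N)
  -- The tree is the component at the end `v` of `e` that becomes a leaf; the other component is the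
  -- one at `z`.
  module Tᶜ = Component (component (A ∖ e) v∈)
  module T′ᶜ = Component (component (A ∖ e) z∈)
  no-second-tree = PendantTree.no-second-tree G k 1≤k connected base e∈B
  fundamental = PendantTree.fundamental G k 1≤k connected base e∈B

  T = Tᶜ.C
  T′ = T′ᶜ.C
  T-component = Tᶜ.isComponent
  T′-component = T′ᶜ.isComponent

  T-connected : Connected T
  T-connected = proj₁ (proj₂ T-component)

  T-nonempty : Nonempty (V T)
  T-nonempty = v , Tᶜ.v∈

  walk-in-T : ∀ {x} → x ∈ V T → Walk (A ∖ e) v x
  walk-in-T x∈ = ⊑-walk (proj₁ T-component) (proj₂ T-connected _ _ Tᶜ.v∈ x∈)

  T∌z : z ∉ V T
  T∌z = separated ∘ walk-in-T

  T⊑A : T ⊑ A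
  T⊑A = proj₁ (proj₁ T-component) , p─q⊆p (E A) ⁅ e ⁆ ∘ proj₂ (proj₁ T-component)

  -- A cycle of `T` is a cycle of `A` that can be reached from `v` without `e`, which `cyclefree`
  -- excludes.
  T-acyclic : Acyclic T
  T-acyclic x p cycle =
    let q , same = transport p (proj₂ T⊑A ∘ walkEdges⊆E p) (proj₁ T⊑A (end-∈V p))
    in cyclefree q (SameTrace⇒IsCycle same cycle) (walk-in-T (end-∈V p))

  edges-of-A : ∀ {f x} → f ∈ B → f ≢ e → Incident x f → x ∈ V A → f ∈ E (A ∖ e)
  edges-of-A f∈B f≢e x~f x∈ = x∈p∧x≢y⇒x∈p-y (component-edges {H = G ⟨ B ⟩} {A} A-component f∈B x~f x∈) f≢e

  edgesAtT : ∀ {f x} → f ∈ B → f ≢ e → Incident x f → x ∈ V T → f ∈ E T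
  edgesAtT f∈B f≢e x~f x∈ = Tᶜ.edgesC (edges-of-A f∈B f≢e x~f (proj₁ T⊑A x∈)) x~f x∈

  edgesAtT′ : ∀ {f x} → f ∈ B → f ≢ e → Incident x f → x ∈ V T′ → f ∈ E T′
  edgesAtT′ f∈B f≢e x~f x∈ = T′ᶜ.edgesC (edges-of-A f∈B f≢e x~f (proj₁ (proj₁ T′-component) x∈)) x~f x∈

  disjoint : ∀ {x} → x ∈ V T → x ∉ V T′
  disjoint x∈T x∈T′ = separated (walk-in-T x∈T ++ʷ
    reverseʷ (⊑-walk (proj₁ T′-component) (proj₂ (proj₁ (proj₂ T′-component)) _ _ T′ᶜ.v∈ x∈T′)))

  -- A walk is stopped just before its first use of `e`, which is at `v` or at `z`.
  cut : ∀ {x} → Walk A x v → Walk (A ∖ e) x v ⊎ Walk (A ∖ e) x z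
  cut (nil _) = inj₁ (nil v∈)
  cut (cons f f∈ j p) with f ≟ e
  ... | no f≢e = map⊎ (cons f f∈A∖e j) (cons f f∈A∖e j) (cut p)
    where f∈A∖e = x∈p∧x≢y⇒x∈p-y f∈ f≢e
  ... | yes refl with Joins-ends {G = G} joins (Joins⇒Incidentˡ {G = G} j)
  ...   | inj₁ refl = inj₁ (nil v∈)
  ...   | inj₂ refl = inj₂ (nil z∈)

  dichotomy : ∀ C → IsComponent C (A ∖ e) → C ≈ T ⊎ C ≈ T′
  -- `A` is connected, so some walk joins the component to `v`; once cut, it puts `v` or `z` into
  -- the component, which determines it.
  dichotomy C isC@(C⊑ , ((x , x∈C) , _) , _) with cut (A-walks _ _ (proj₁ C⊑ x∈C) v∈)
  ... | inj₁ p = inj₁ (≈-sym {H = T} {C} (Tᶜ.unique isC (closed-walk (component-closed {H = A ∖ e} {C} isC) x∈C p)))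
  ... | inj₂ p = inj₂ (≈-sym {H = T′} {C} (T′ᶜ.unique isC (closed-walk (component-closed {H = A ∖ e} {C} isC) x∈C p)))
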